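{- Let $T=(\mathcal L,\mathcal R)$ be an R-GT system and $\mathbf D\subseteq\mathcal G^{\oplus}(\mathcal L)$. If all non-garbage critical pairs of $T$ with respect to $\mathbf D$ are strongly joinable, then $T$ is locally confluent on $\mathbf D$.
   Context: Fix a label alphabet $\mathcal L=(\mathcal L_V,\mathcal L_E)$. Graphs are $G=(V,E,s,t,l,m,p)$ with $V,E$ finite, $s,t:E\to V$ total, $l:V\rightharpoonup\mathcal L_V$ partial, $m:E\to\mathcal L_E$ total, $p:V\rightharpoonup\{0,1\}$ partial (rootedness); TLRG = $l,p$ total; $\mathcal G^{\oplus}(\mathcal L)$ is the set of isomorphism classes $[G]$ of TLRGs. Morphisms preserve sources, targets, edge labels, and node labels and rootedness wherever defined. A rule $\langle L\leftarrow K\rightarrow R\rangle$ has TLRGs $L,R$ and a common subgraph $K$ (sets included, $s,t,m$ restricted, $l_K\subseteq l_L$, $p_K\subseteq p_L$, likewise for $R$). A direct derivation $G\Rightarrow_{r,g}H$ applies $r$ to TLRG $G$ via an injective match $g$ satisfying the dangling condition (no edge outside $g(L)$ incident to a node of $g(V_L\setminus V_K)$): delete images of items of $L$ not in $K$ and undefine label/rootedness of $g_V(v)$ where undefined for $v\in V_K$, giving $D$; add disjointly items of $R$ not in $K$ and set label/rootedness of $g_V(v)$ to $l_R(v)/p_R(v)$ where undefined in $K$, giving $H$. An R-GT system $T=(\mathcal L,\mathcal R)$ has a finite rule set. The track of $G\Rightarrow H$ is the partial map $G\rightharpoonup H$ that is the identity (via $D$) on nodes and edges of $D$ and undefined elsewhere;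 tracks of sequences are composites. Steps $H_1\Leftarrow_{r_1,g_1}G\Rightarrow_{r_2,g_2}H_2$ are parallelly independent if $g_1(L_1)\cap g_2(L_2)\subseteq g_1(K_1)\cap g_2(K_2)$; such a pair is a critical pair if $G=g_1(L_1)\cup g_2(L_2)$, the steps are not parallelly independent, and $g_1\ne g_2$ if $r_1=r_2$. Persistent nodes: nodes of $G$ where both tracks $G\Rightarrow H_i$ are defined. Strongly joinable: there exist $M$ and $H_1\Rightarrow^*M\Leftarrow^*H_2$ whose full tracks from $G$ are defined and agree on every persistent node. For TLRGs, $H$ is a subgraph of $G$ if $V_H\subseteq V_G$, $E_H\subseteq E_G$ and $s,t,m,l,p$ of $H$ are the restrictions of those of $G$. $\mathbf D$ is subgraph closed if $[G]\in\mathbf D$ and $H$ a subgraph of $G$ imply $[H]\in\mathbf D$; $\overline{\mathbf D}$ is the smallest subgraph-closed set containing $\mathbf D$; a critical pair with start graph $G$ is non-garbage w.r.t. $\mathbf D$ if $[G]\in\overline{\mathbf D}$. $H_1,H_2$ are joinable if $H_1\Rightarrow^*M\Leftarrow^*H_2$ for some $M$. $T$ is locally confluent on $\mathbf D$ if for all TLRGs $G$ with $[G]\in\mathbf D$, $H_1\Leftarrow G\Rightarrow H_2$ implies $H_1,H_2$ joinable. -}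

module Defs where

open import Level using (Level; 0ℓ; _⊔_) renaming (suc to lsuc)
open import Data.Bool.Base using (Bool)
open import Data.Fin.Base using (Fin)
open import Data.Maybe using (Maybe; just; nothing; Is-just)
open import Data.Nat.Base using (ℕ)
open import Data.Product.Base using (Σ; ∃; ∃-syntax; _×_; _,_)
open import Data.Unit.Base using (⊤)
open import Function.Base using (_∘_)
open import Function.Bundles using (_↔_; _⇔_)
open import Function.Definitions using (Injective)
open import Relation.Binary.PropositionalEquality
  using (_≡_; _≢_; refl; sym; trans; cong; subst)
open import Relation.Nullary.Negation.Core using (¬_)
open import Relation.Unary using (Pred; _∈_; _∉_; _∩_; _∪_; _⊆_)

private variable
  ℓ : Level

record LabelAlphabet : Set₁ where
  field
    LV LE : Set

private variable
  𝓛 : LabelAlphabet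

-- The enumerations express finiteness; nothing depends on their choice.
record Graph (𝓛 : LabelAlphabet) : Set₁ where
  open LabelAlphabet 𝓛
  field
    V E     : Set
    |V| |E| : ℕ
    V-fin   : V ↔ Fin |V|
    E-fin   : E ↔ Fin |E|
    s t     : E → V
    l       : V → Maybe LV
    m       : E → LE
    p       : V → Maybe Bool

-- Totally labelled rooted graphs.
record TLRG (𝓛 : LabelAlphabet) : Set₁ where
  field
    graph   : Graph 𝓛
  open Graph graph public
  field
    l-total : ∀ v → Is-just (l v)
    p-total : ∀ v → Is-just (p v)

open TLRG using (graph)

record Morphism (G H : Graph 𝓛) : Set where
  private
    module G = Graph G
    module H = Graph H
  field
    onV    : G.V → H.V
    onE    : G.E → H.E
    s-pres : ∀ e → H.s (onE e) ≡ onV (G.s e)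
    t-pres : ∀ e → H.t (onE e) ≡ onV (G.t e)
    m-pres : ∀ e → H.m (onE e) ≡ G.m e
    l-pres : ∀ v {a} → G.l v ≡ just a → H.l (onV v) ≡ just a
    p-pres : ∀ v {b} → G.p v ≡ just b → H.p (onV v) ≡ just b

-- Injective morphisms.  Up to renaming of items these are the inclusions
-- "sets included, s, t, m restricted, l ⊆ l′ and p ⊆ p′ as partial functions".
record _↪_ (G H : Graph 𝓛) : Set where
  field
    morphism : Morphism G H
  open Morphism morphism public
  field
    injV : Injective _≡_ _≡_ onV
    injE : Injective _≡_ _≡_ onE

record _≅_ (G H : Graph 𝓛) : Set where
  field
    to   : Morphism G H
    from : Morphism H G
  private
    module to   = Morphism to
    module from = Morphism from
  field
    from-toV : ∀ v → from.onV (to.onV v) ≡ v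
    from-toE : ∀ e → from.onE (to.onE e) ≡ e
    to-fromV : ∀ v → to.onV (from.onV v) ≡ v
    to-fromE : ∀ e → to.onE (from.onE e) ≡ e

im : {A B : Set} → (A → B) → Pred B 0ℓ
im f y = ∃[ x ] f x ≡ y

_∘↪_ : {F G H : Graph 𝓛} → G ↪ H → F ↪ G → F ↪ H
_∘↪_ g f = record
  { morphism = record
    { onV    = g.onV ∘ f.onV
    ; onE    = g.onE ∘ f.onE
    ; s-pres = λ e → trans (g.s-pres (f.onE e)) (cong g.onV (f.s-pres e))
    ; t-pres = λ e → trans (g.t-pres (f.onE e)) (cong g.onV (f.t-pres e))
    ; m-pres = λ e → trans (g.m-pres (f.onE e)) (f.m-pres e)
    ; l-pres = λ v q → g.l-pres (f.onV v) (f.l-pres v q)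
    ; p-pres = λ v q → g.p-pres (f.onV v) (f.p-pres v q)
    }
  ; injV = f.injV ∘ g.injV
  ; injE = f.injE ∘ g.injE
  }
  where
  module f = _↪_ f
  module g = _↪_ g

-- Subgraphs of a fixed graph G, possibly with fewer labels than G.
-- Partial labellings are compared as sets of pairs, so _⊑_ below also
-- requires every label and rootedness value defined on the left to be
-- defined on the right.
record Part (G : Graph 𝓛) : Set₁ where
  open Graph G
  open LabelAlphabet 𝓛
  field
    nodes  : Pred V 0ℓ
    edges  : Pred E 0ℓ
    labels : Pred (V × LV) 0ℓ
    roots  : Pred (V × Bool) 0ℓ

open Part

whole : (G : Graph 𝓛) → Part G
whole G = record
  { nodes  = λ _ → ⊤
  ; edges  = λ _ → ⊤
  ; labels = λ (v , a) → l v ≡ just a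
  ; roots  = λ (v , b) → p v ≡ just b
  }
  where open Graph G

image : {F G : Graph 𝓛} → F ↪ G → Part G
image {F = F} f = record
  { nodes  = im onV
  ; edges  = im onE
  ; labels = λ (v , a) → ∃[ x ] onV x ≡ v × F.l x ≡ just a
  ; roots  = λ (v , b) → ∃[ x ] onV x ≡ v × F.p x ≡ just b
  }
  where
  module F = Graph F
  open _↪_ f

module _ {G : Graph 𝓛} where

  infixr 7 _⊓_
  infixr 6 _⊔ᴾ_
  infix  4 _⊑_

  _⊓_ _⊔ᴾ_ : Part G → Part G → Part G
  P ⊓ Q = record
    { nodes  = nodes P ∩ nodes Q
    ; edges  = edges P ∩ edges Q
    ; labels = labels P ∩ labels Q
    ; roots  = roots P ∩ roots Q
    }
  P ⊔ᴾ Q = record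
    { nodes  = nodes P ∪ nodes Q
    ; edges  = edges P ∪ edges Q
    ; labels = labels P ∪ labels Q
    ; roots  = roots P ∪ roots Q
    }

  _⊑_ : Part G → Part G → Set
  P ⊑ Q = (nodes P ⊆ nodes Q) × (edges P ⊆ edges Q)
        × (labels P ⊆ labels Q) × (roots P ⊆ roots Q)

record Rule (𝓛 : LabelAlphabet) : Set₁ where
  field
    L R  : TLRG 𝓛
    K    : Graph 𝓛
    incL : K ↪ graph L
    incR : K ↪ graph R

-- The finite rule set is enumerated; rules are identified by their index.
record R-GTSystem (𝓛 : LabelAlphabet) : Set₁ where
  field
    #rules : ℕ
    rule   : Fin #rules → Rule 𝓛

-- H is determined up to isomorphism by r, G and g; the record describes all
-- representatives of that isomorphism class.
record DirectDerivation (r : Rule 𝓛) (G : TLRG 𝓛)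
                        (g : graph (Rule.L r) ↪ graph G)
                        (H : TLRG 𝓛) : Set₁ where
  open Rule r public
  private
    module L    = TLRG L
    module R    = TLRG R
    module K    = Graph K
    module G    = TLRG G
    module H    = TLRG H
    module g    = _↪_ g
    module incL = _↪_ incL
    module incR = _↪_ incR
  field
    dangling : ∀ e → e ∉ im g.onE → ∀ x → x ∉ im incL.onV →
               (G.s e ≢ g.onV x) × (G.t e ≢ g.onV x)

    D        : Graph 𝓛
    D⊆G      : D ↪ graph G
  module D   = Graph D
  module D⊆G = _↪_ D⊆G
  field
    D-nodes  : ∀ v → v ∈ im D⊆G.onV ⇔
                     (¬ (∃[ x ] x ∉ im incL.onV × g.onV x ≡ v))
    D-edges  : ∀ e → e ∈ im D⊆G.onE ⇔
                     (¬ (∃[ x ] x ∉ im incL.onE × g.onE x ≡ e))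
    l-undef  : ∀ d k → D⊆G.onV d ≡ g.onV (incL.onV k) →
               K.l k ≡ nothing → D.l d ≡ nothing
    l-keep   : ∀ d →
               (∀ k → D⊆G.onV d ≡ g.onV (incL.onV k) → K.l k ≢ nothing) →
               D.l d ≡ G.l (D⊆G.onV d)
    p-undef  : ∀ d k → D⊆G.onV d ≡ g.onV (incL.onV k) →
               K.p k ≡ nothing → D.p d ≡ nothing
    p-keep   : ∀ d →
               (∀ k → D⊆G.onV d ≡ g.onV (incL.onV k) → K.p k ≢ nothing) →
               D.p d ≡ G.p (D⊆G.onV d)

    -- H is D together with disjoint copies of the items of R outside K.
    -- As R is totally labelled, h being a morphism that agrees with D⊆H on K
    -- says that labels and rootedness undefined in K are set from R.
    D⊆H      : D ↪ graph H
    h        : graph R ↪ graph H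
  module D⊆H = _↪_ D⊆H
  module h   = _↪_ h
  field
    glueV    : ∀ d k → D⊆G.onV d ≡ g.onV (incL.onV k) →
               D⊆H.onV d ≡ h.onV (incR.onV k)
    glueE    : ∀ d k → D⊆G.onE d ≡ g.onE (incL.onE k) →
               D⊆H.onE d ≡ h.onE (incR.onE k)
    freshV   : ∀ y → y ∉ im incR.onV → h.onV y ∉ im D⊆H.onV
    freshE   : ∀ y → y ∉ im incR.onE → h.onE y ∉ im D⊆H.onE
    coverV   : ∀ w → w ∈ im D⊆H.onV ∪ im h.onV
    coverE   : ∀ e → e ∈ im D⊆H.onE ∪ im h.onE

module _ (T : R-GTSystem 𝓛) where
  open R-GTSystem T

  record Step (G H : TLRG 𝓛) : Set₁ where
    field
      index      : Fin #rules
      match      : graph (Rule.L (rule index)) ↪ graph G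
      derivation : DirectDerivation (rule index) G match H
    open DirectDerivation derivation public

  -- Since results of steps are only determined up to isomorphism, a derivation
  -- sequence may end with an isomorphism (in particular the identity).
  data Steps (G : TLRG 𝓛) (H : TLRG 𝓛) : Set₁ where
    done : graph G ≅ graph H → Steps G H
    _◅_  : ∀ {G′} → Step G G′ → Steps G′ H → Steps G H

module _ {T : R-GTSystem 𝓛} where

  -- Tracks are partial maps, given by their graphs.  Only their node
  -- components are needed for strong joinability.
  track : ∀ {G H} → Step T G H → TLRG.V G → TLRG.V H → Set
  track π v w = ∃[ d ] D⊆G.onV d ≡ v × D⊆H.onV d ≡ w
    where open Step π

  track* : ∀ {G H} → Steps T G H → TLRG.V G → TLRG.V H → Set
  track* (done i)     v w = Morphism.onV (_≅_.to i) v ≡ w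
  track* (π ◅ πs)     v w = ∃[ u ] track π v u × track* πs u w

module _ (T : R-GTSystem 𝓛) where
  open R-GTSystem T

  Joinable : TLRG 𝓛 → TLRG 𝓛 → Set₁
  Joinable H₁ H₂ = ∃[ M ] Steps T H₁ M × Steps T H₂ M

  module _ {G H₁ H₂ : TLRG 𝓛} (π₁ : Step T G H₁) (π₂ : Step T G H₂) where
    private
      module G  = TLRG G
      module π₁ = Step π₁
      module π₂ = Step π₂
      module g₁ = _↪_ π₁.match
      module g₂ = _↪_ π₂.match

    -- The comparison includes labels and rootedness: an item of the overlap
    -- whose label or rootedness is undefined in K₁ or K₂ is a conflict.
    ParallellyIndependent : Set
    ParallellyIndependent =
      image π₁.match ⊓ image π₂.match
        ⊑ image (π₁.match ∘↪ π₁.incL) ⊓ image (π₂.match ∘↪ π₂.incL)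

    SameMatch : Set
    SameMatch = Σ (π₁.index ≡ π₂.index) λ eq →
        (∀ v → g₁.onV v ≡ g₂.onV (subst (λ i → TLRG.V (Rule.L (rule i))) eq v))
      × (∀ e → g₁.onE e ≡ g₂.onE (subst (λ i → TLRG.E (Rule.L (rule i))) eq e))

    record CriticalPair : Set where
      field
        covers      : whole (graph G) ⊑ image π₁.match ⊔ᴾ image π₂.match
        conflicting : ¬ ParallellyIndependent
        distinct    : ¬ SameMatch

    Persistent : G.V → Set
    Persistent v = (∃[ w ] track π₁ v w) × (∃[ w ] track π₂ v w)

    StronglyJoinable : Set₁
    StronglyJoinable =
      ∃[ M ] Σ (Steps T H₁ M) λ σ₁ → Σ (Steps T H₂ M) λ σ₂ →
        ∀ v → Persistent v →
          ∃[ w ] track* (π₁ ◅ σ₁) v w × track* (π₂ ◅ σ₂) v w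

record GraphClass (𝓛 : LabelAlphabet) (ℓ : Level) : Set (lsuc ℓ) where
  field
    member : TLRG 𝓛 → Set ℓ
    resp-≅ : ∀ {G H} → graph G ≅ graph H → member G → member H

-- The subgraph relation on TLRGs, up to renaming of the items of H.
record SubgraphOf (G H : TLRG 𝓛) : Set where
  private
    module G = TLRG G
    module H = TLRG H
  field
    onV     : H.V → G.V
    onE     : H.E → G.E
    injV    : Injective _≡_ _≡_ onV
    injE    : Injective _≡_ _≡_ onE
    s-restr : ∀ e → onV (H.s e) ≡ G.s (onE e)
    t-restr : ∀ e → onV (H.t e) ≡ G.t (onE e)
    m-restr : ∀ e → H.m e ≡ G.m (onE e)
    l-restr : ∀ v → H.l v ≡ G.l (onV v)
    p-restr : ∀ v → H.p v ≡ G.p (onV v)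

SubgraphClosed : GraphClass 𝓛 ℓ → Set (lsuc 0ℓ ⊔ ℓ)
SubgraphClosed D = ∀ {G H} → SubgraphOf G H → member G → member H
  where open GraphClass D

data Closure (D : GraphClass 𝓛 ℓ) : TLRG 𝓛 → Set (lsuc 0ℓ ⊔ ℓ) where
  base : ∀ {G}   → GraphClass.member D G → Closure D G
  sub  : ∀ {G H} → SubgraphOf G H → Closure D G → Closure D H

private
  preserved⇒≡ : {A : Set} {x y : Maybe A} → Is-just x →
                (∀ {a} → x ≡ just a → y ≡ just a) → x ≡ y
  preserved⇒≡ {x = just a} _ f = sym (f refl)

≅⇒SubgraphOf : {G H : TLRG 𝓛} → graph G ≅ graph H → SubgraphOf G H
≅⇒SubgraphOf {G = G} {H = H} i = record
  { onV     = onV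
  ; onE     = onE
  ; injV    = λ {v} {w} q →
                trans (sym (to-fromV v)) (trans (cong to.onV q) (to-fromV w))
  ; injE    = λ {e} {f} q →
                trans (sym (to-fromE e)) (trans (cong to.onE q) (to-fromE f))
  ; s-restr = λ e → sym (s-pres e)
  ; t-restr = λ e → sym (t-pres e)
  ; m-restr = λ e → sym (m-pres e)
  ; l-restr = λ v → preserved⇒≡ (TLRG.l-total H v) (l-pres v)
  ; p-restr = λ v → preserved⇒≡ (TLRG.p-total H v) (p-pres v)
  }
  where
  open _≅_ i
  open Morphism from
  module to = Morphism to

closure : GraphClass 𝓛 ℓ → GraphClass 𝓛 (lsuc 0ℓ ⊔ ℓ)
closure D = record
  { member = Closure D
  ; resp-≅ = λ i → sub (≅⇒SubgraphOf i)
  }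

closure-closed : (D : GraphClass 𝓛 ℓ) → SubgraphClosed (closure D)
closure-closed D = sub

closure-least : ∀ {ℓ′} (D : GraphClass 𝓛 ℓ) (C : GraphClass 𝓛 ℓ′) →
                SubgraphClosed C →
                (∀ {G} → GraphClass.member D G → GraphClass.member C G) →
                ∀ {G} → GraphClass.member (closure D) G → GraphClass.member C G
closure-least D C closed D⊆C (base G∈D)  = D⊆C G∈D
closure-least D C closed D⊆C (sub H≤G q) =
  closed H≤G (closure-least D C closed D⊆C q)

module _ (T : R-GTSystem 𝓛) (D : GraphClass 𝓛 ℓ) where

  NonGarbage : {G H₁ H₂ : TLRG 𝓛} {π₁ : Step T G H₁} {π₂ : Step T G H₂} →
               CriticalPair T π₁ π₂ → Set (lsuc 0ℓ ⊔ ℓ)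
  NonGarbage {G = G} _ = GraphClass.member (closure D) G

  LocallyConfluentOn : Set (lsuc 0ℓ ⊔ ℓ)
  LocallyConfluentOn =
    ∀ {G H₁ H₂} → GraphClass.member D G →
    Step T G H₁ → Step T G H₂ → Joinable T H₁ H₂

{-# OPTIONS --safe #-}
module Submission where

open import Axiom.UniquenessOfIdentityProofs.WithK using (uip)
open import Data.Bool.Base using (Bool)
open import Data.Empty using (⊥-elim-irr)
open import Data.Fin.Base using (Fin; zero; suc)
open import Data.Fin.Properties as Fin using (+↔⊎; any?; all?)
open import Data.Irrelevant using () renaming ([_] to irr)
open import Data.Maybe using (Maybe; just; nothing; Is-just)
open import Data.Maybe.Relation.Unary.Any using (just)
open import Data.Nat.Base as ℕ using (ℕ)
open import Data.Product.Base as Product using (∃; ∃-syntax; _×_; _,_; proj₁; proj₂; map₂)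
open import Data.Refinement as Refinement using (Refinement; _,_; value; proof; value-injective)
open import Data.Sum.Base as Sum using (_⊎_; inj₁; inj₂; [_,_]; [_,_]′)
open import Data.Sum.Function.Propositional using (_⊎-↔_)
open import Data.Sum.Properties using (inj₁-injective)
open import Function.Base using (_∘_; id)
open import Function.Bundles using (_↔_; _⇔_; Inverse; Equivalence; mk↔ₛ′; mk⇔)
open import Function.Definitions using (Injective)
open import Function.Properties.Inverse using (↔⇒↣; ↔-sym; ↔-trans)
open import Level using (Level; 0ℓ)
open import Relation.Binary.Definitions using (DecidableEquality)
open import Relation.Binary.PropositionalEquality
  using (_≡_; _≢_; refl; sym; trans; cong; subst; module ≡-Reasoning)
open import Relation.Nullary.Decidable
  using (Dec; yes; no; map′; ¬?; decidable-stable; recompute; _×-dec_; _⊎-dec_; _→-dec_)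
open import Relation.Nullary.Negation.Core using (¬_; contradiction)
open import Relation.Nullary.Recomputable using (¬-recompute)
open import Relation.Unary using (Pred; Decidable; _∈_; _∉_)
open import Defs
open TLRG using (graph)

-- If the two steps from G use the same match, their results are isomorphic; if
-- they are independent, each match has a residual after the other step and
-- applying the residuals leads to isomorphic graphs.  Otherwise both steps
-- restrict to the union S of their matches, where they form a non-garbage
-- critical pair.  An edge of G outside S is attached to S in persistent nodes
-- only, by the dangling condition.  So G is S with a context glued to
-- persistent nodes, and since the joining derivations of S track these nodes
-- to the same nodes of their common result M, the context can be carried along
-- both derivations and ends up glued to M in the same way.

-- All case distinctions are decided by finiteness of the graphs, and the negative clauses of a
-- direct derivation are turned into witnesses in the same way. Nodes and edges obey the same
-- replacement laws, so these are studied once, on plain sets, with the auxiliary graph D hidden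
-- behind the track relation. The obstacle is that a joining sequence is given for S alone, and
-- every intermediate graph has its own nodes. The context is therefore formulated over an abstract
-- set B of attachment points: it stays fixed along a derivation, and only the map from B to the
-- current graph changes. That the track is defined on all of B says that no step deletes an
-- attachment point, so the dangling condition persists when the context edges are added. The same
-- construction yields the existence of direct derivations: a rule is a derivation from L to R, and
-- the graph around a match is a context of L.

private variable
  ℓ : Level
  𝓛 : LabelAlphabet

-- Finite sets

module _ {A : Set} {n} (fin : A ↔ Fin n) where
  open Inverse fin

  ≟-fin : DecidableEquality A
  ≟-fin = Fin.inj⇒≟ (↔⇒↣ fin)

  ∃?-fin : {P : Pred A ℓ} → Decidable P → Dec (∃ P)
  ∃?-fin {P = P} P? = map′ (λ (i , p) → from i , p)
    (λ (x , p) → to x , subst P (sym (strictlyInverseʳ x)) p)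
    (any? (P? ∘ from))

  ∀?-fin : {P : Pred A ℓ} → Decidable P → Dec (∀ x → P x)
  ∀?-fin {P = P} P? = map′ (λ p x → subst P (strictlyInverseʳ x) (p (to x)))
    (λ p i → p (from i)) (all? (P? ∘ from))

im? : {A B : Set} {m n : ℕ} → A ↔ Fin m → B ↔ Fin n → (f : A → B) → Decidable (im f)
im? finA finB f y = ∃?-fin finA (λ x → ≟-fin finB (f x) y)

-- Membership proofs in a `Refinement` are irrelevant, so an index is counted once, however many
-- proofs of `P` it has.
Refinement-fin : ∀ {n} {P : Pred (Fin n) ℓ} → Decidable P →
                 ∃[ k ] Refinement (Fin n) P ↔ Fin k
Refinement-fin {n = ℕ.zero} P? =
  0 , mk↔ₛ′ (λ { (() , _) }) (λ ()) (λ ()) (λ { (() , _) })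
Refinement-fin {n = ℕ.suc n} {P} P? with P? zero | Refinement-fin (P? ∘ suc)
... | yes p | k , i = ℕ.suc k , mk↔ₛ′ f g
        (λ { zero → refl ; (suc j) → cong suc (strictlyInverseˡ j) }) gf
  where
  open Inverse i
  f : Refinement (Fin (ℕ.suc n)) P → Fin (ℕ.suc k)
  f (zero  , _) = zero
  f (suc j , q) = suc (to (j , q))
  g : Fin (ℕ.suc k) → Refinement (Fin (ℕ.suc n)) P
  g zero    = zero , irr p
  g (suc j) = suc (value (from j)) , proof (from j)
  gf : ∀ x → g (f x) ≡ x
  gf (zero  , _) = refl
  gf (suc j , q) = value-injective (cong (suc ∘ value) (strictlyInverseʳ (j , q)))
... | no ¬p | k , i = k , mk↔ₛ′ f g strictlyInverseˡ gf
  where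
  open Inverse i
  f : Refinement (Fin (ℕ.suc n)) P → Fin k
  f (zero  , irr q) = ⊥-elim-irr (¬p q)
  f (suc j , q)     = to (j , q)
  g : Fin k → Refinement (Fin (ℕ.suc n)) P
  g j = suc (value (from j)) , proof (from j)
  gf : ∀ x → g (f x) ≡ x
  gf (zero  , irr q) = ⊥-elim-irr (¬p q)
  gf (suc j , q)     = value-injective (cong (suc ∘ value) (strictlyInverseʳ (j , q)))

refine-↔ : {A : Set} {B : Set} (i : A ↔ B) {P : Pred A ℓ} →
           Refinement A P ↔ Refinement B (P ∘ Inverse.from i)
refine-↔ i {P} = mk↔ₛ′
  (λ (x , irr p) → to x , irr (subst P (sym (strictlyInverseʳ x)) p))
  (λ (y , p) → from y , p)
  (λ y → value-injective (strictlyInverseˡ (value y)))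
  (λ x → value-injective (strictlyInverseʳ (value x)))
  where open Inverse i

Refinement-finite : {A : Set} {n : ℕ} → A ↔ Fin n → {P : Pred A ℓ} → Decidable P →
                    ∃[ k ] Refinement A P ↔ Fin k
Refinement-finite fin P? =
  map₂ (↔-trans (refine-↔ fin)) (Refinement-fin (P? ∘ Inverse.from fin))

-- Isomorphisms

≅-refl : {G : Graph 𝓛} → G ≅ G
≅-refl = record
  { to = id-morphism ; from = id-morphism
  ; from-toV = λ _ → refl ; from-toE = λ _ → refl
  ; to-fromV = λ _ → refl ; to-fromE = λ _ → refl
  }
  where
  id-morphism = record
    { onV = id ; onE = id
    ; s-pres = λ _ → refl ; t-pres = λ _ → refl ; m-pres = λ _ → refl
    ; l-pres = λ _ q → q ; p-pres = λ _ q → q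
    }

≅-sym : {G H : Graph 𝓛} → G ≅ H → H ≅ G
≅-sym i = record
  { to = from ; from = to
  ; from-toV = to-fromV ; from-toE = to-fromE
  ; to-fromV = from-toV ; to-fromE = from-toE
  }
  where open _≅_ i

≅⇒↪ : {G H : Graph 𝓛} → G ≅ H → G ↪ H
≅⇒↪ i = record
  { morphism = to
  ; injV = λ {v} {w} q → trans (sym (from-toV v)) (trans (cong from.onV q) (from-toV w))
  ; injE = λ {e} {f} q → trans (sym (from-toE e)) (trans (cong from.onE q) (from-toE f))
  }
  where
  open _≅_ i
  module from = Morphism from

just-total : {A : Set} {x : Maybe A} → Is-just x → ∃[ a ] x ≡ just a
just-total (just _) = _ , refl

total-⊆⇒≡ : {A : Set} {x y : Maybe A} → Is-just x →
            (∀ {a} → x ≡ just a → y ≡ just a) → x ≡ y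
total-⊆⇒≡ x↓ x⊆y with just-total x↓
... | _ , q = trans q (sym (x⊆y q))

module _ {G H : TLRG 𝓛} where
  private
    module G = TLRG G
    module H = TLRG H

  ↪-l : (f : graph G ↪ graph H) → ∀ v → H.l (_↪_.onV f v) ≡ G.l v
  ↪-l f v = sym (total-⊆⇒≡ (G.l-total v) (_↪_.l-pres f v))

  ↪-p : (f : graph G ↪ graph H) → ∀ v → H.p (_↪_.onV f v) ≡ G.p v
  ↪-p f v = sym (total-⊆⇒≡ (G.p-total v) (_↪_.p-pres f v))

  -- This relies on total labellings: otherwise the target could carry labels that the source lacks.
  -- By `↪-l` and `↪-p` the inverse preserves labels and rootedness too.
  bijective⇒≅ : (f : graph G ↪ graph H) → (∀ w → w ∈ im (_↪_.onV f)) →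
                (∀ e → e ∈ im (_↪_.onE f)) → graph G ≅ graph H
  bijective⇒≅ f surjV surjE = record
    { to   = morphism
    ; from = record
      { onV    = proj₁ ∘ surjV
      ; onE    = proj₁ ∘ surjE
      ; s-pres = λ e → let e′ , q = surjE e in injV (trans (sym (s-pres e′))
                   (trans (cong H.s q) (sym (proj₂ (surjV (H.s e))))))
      ; t-pres = λ e → let e′ , q = surjE e in injV (trans (sym (t-pres e′))
                   (trans (cong H.t q) (sym (proj₂ (surjV (H.t e))))))
      ; m-pres = λ e → let e′ , q = surjE e in trans (sym (m-pres e′)) (cong H.m q)
      ; l-pres = λ w q → let v , r = surjV w in
                   trans (sym (↪-l f v)) (trans (cong H.l r) q)
      ; p-pres = λ w q → let v , r = surjV w in
                   trans (sym (↪-p f v)) (trans (cong H.p r) q)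
      }
    ; from-toV = λ v → injV (proj₂ (surjV (onV v)))
    ; from-toE = λ e → injE (proj₂ (surjE (onE e)))
    ; to-fromV = proj₂ ∘ surjV
    ; to-fromE = proj₂ ∘ surjE
    }
    where open _↪_ f

≅-trans : {F G H : Graph 𝓛} → F ≅ G → G ≅ H → F ≅ H
≅-trans i j = record
  { to   = _↪_.morphism (≅⇒↪ j ∘↪ ≅⇒↪ i)
  ; from = _↪_.morphism (≅⇒↪ (≅-sym i) ∘↪ ≅⇒↪ (≅-sym j))
  ; from-toV = λ v → trans (cong i.from.onV (j.from-toV _)) (i.from-toV v)
  ; from-toE = λ e → trans (cong i.from.onE (j.from-toE _)) (i.from-toE e)
  ; to-fromV = λ v → trans (cong j.to.onV (i.to-fromV _)) (j.to-fromV v)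
  ; to-fromE = λ e → trans (cong j.to.onE (i.to-fromE _)) (j.to-fromE e)
  }
  where
  module i where
    open _≅_ i public
    module to = Morphism to
    module from = Morphism from
  module j where
    open _≅_ j public
    module to = Morphism to
    module from = Morphism from

-- A morphism in relational form. An item of a result can have several origins at once; a relation
-- may list them all and leaves single-valuedness as a separate obligation.
record Simulation (G H : TLRG 𝓛) (_~V_ : TLRG.V G → TLRG.V H → Set)
                  (_~E_ : TLRG.E G → TLRG.E H → Set) : Set where
  private
    module G = TLRG G
    module H = TLRG H
  field
    totalV      : ∀ v → ∃ (v ~V_)
    totalE      : ∀ e → ∃ (e ~E_)
    functionalV : ∀ {v w w′} → v ~V w → v ~V w′ → w ≡ w′
    functionalE : ∀ {e f f′} → e ~E f → e ~E f′ → f ≡ f′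
    s-compat    : ∀ {e f} → e ~E f → G.s e ~V H.s f
    t-compat    : ∀ {e f} → e ~E f → G.t e ~V H.t f
    m-compat    : ∀ {e f} → e ~E f → G.m e ≡ H.m f
    l-compat    : ∀ {v w} → v ~V w → G.l v ≡ H.l w
    p-compat    : ∀ {v w} → v ~V w → G.p v ≡ H.p w

module _ {G H : TLRG 𝓛}
         {_~V_ : TLRG.V G → TLRG.V H → Set} {_~E_ : TLRG.E G → TLRG.E H → Set}
         {_≈V_ : TLRG.V H → TLRG.V G → Set} {_≈E_ : TLRG.E H → TLRG.E G → Set}
         (φ : Simulation G H _~V_ _~E_) (ψ : Simulation H G _≈V_ _≈E_)
         (~⇒≈V : ∀ {v w} → v ~V w → w ≈V v) (~⇒≈E : ∀ {e f} → e ~E f → f ≈E e)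
         (≈⇒~V : ∀ {v w} → w ≈V v → v ~V w) (≈⇒~E : ∀ {e f} → f ≈E e → e ~E f)
         where
  private
    module φ = Simulation φ
    module ψ = Simulation ψ

  -- Functionality of the converse gives injectivity, its totality gives surjectivity. For a
  -- symmetric construction one simulation argument, used twice, is enough.
  simulations⇒≅ : graph G ≅ graph H
  simulations⇒≅ = bijective⇒≅ {G = G} {H = H}
    (record
      { morphism = record
        { onV    = proj₁ ∘ φ.totalV
        ; onE    = proj₁ ∘ φ.totalE
        ; s-pres = λ e → φ.functionalV (φ.s-compat (proj₂ (φ.totalE e))) (proj₂ (φ.totalV _))
        ; t-pres = λ e → φ.functionalV (φ.t-compat (proj₂ (φ.totalE e))) (proj₂ (φ.totalV _))
        ; m-pres = λ e → sym (φ.m-compat (proj₂ (φ.totalE e)))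
        ; l-pres = λ v → trans (sym (φ.l-compat (proj₂ (φ.totalV v))))
        ; p-pres = λ v → trans (sym (φ.p-compat (proj₂ (φ.totalV v))))
        }
      ; injV = λ {v} {w} q → ψ.functionalV
          (subst (_≈V v) q (~⇒≈V (proj₂ (φ.totalV v)))) (~⇒≈V (proj₂ (φ.totalV w)))
      ; injE = λ {e} {f} q → ψ.functionalE
          (subst (_≈E e) q (~⇒≈E (proj₂ (φ.totalE e)))) (~⇒≈E (proj₂ (φ.totalE f)))
      })
    (λ w → let v , r = ψ.totalV w in v , φ.functionalV (proj₂ (φ.totalV v)) (≈⇒~V r))
    (λ f → let e , r = ψ.totalE f in e , φ.functionalE (proj₂ (φ.totalE e)) (≈⇒~E r))

-- Single replacement steps on the level of sets

record Span : Set₁ where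
  field
    K L R  : Set
    incL   : K → L
    incR   : K → R
    size   : ℕ
    finite : K ↔ Fin size
    _≟L_   : DecidableEquality L
    _≟R_   : DecidableEquality R

-- The node part or the edge part of a direct derivation, with D replaced by
-- the track relation that it induces.
record Replacement (S : Span) (G H : Set) : Set₁ where
  open Span S
  infix 4 _↝_
  field
    g          : L → G
    h          : R → H
    _↝_        : G → H → Set
    h-inj      : Injective _≡_ _≡_ h
    functional : ∀ {v w w′} → v ↝ w → v ↝ w′ → w ≡ w′
    injective  : ∀ {v v′ w} → v ↝ w → v′ ↝ w → v ≡ v′
    survives   : ∀ v → (∀ x → g x ≡ v → x ∈ im incL) → ∃ (v ↝_)
    preserved  : ∀ {v w x} → v ↝ w → g x ≡ v → x ∈ im incL
    interface  : ∀ k → g (incL k) ↝ h (incR k)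
    absorbed   : ∀ {v w y} → v ↝ w → h y ≡ w → ∃[ k ] incR k ≡ y × g (incL k) ≡ v
    cover      : ∀ w → (∃[ v ] v ↝ w) ⊎ w ∈ im h

module _ (S : Span) where
  open Span S

  -- Deciding membership in the images of K makes the negative clauses positive: `D-char` yields
  -- `preserved`, and `fresh` yields `absorbed`, where injectivity of `dH` identifies the origin.
  replacement :
    {G D H : Set} {g : L → G} {h : R → H} {dG : D → G} {dH : D → H} →
    Injective _≡_ _≡_ g → Injective _≡_ _≡_ h →
    Injective _≡_ _≡_ dG → Injective _≡_ _≡_ dH →
    (∀ v → v ∈ im dG ⇔ (¬ (∃[ x ] x ∉ im incL × g x ≡ v))) →
    (∀ d k → dG d ≡ g (incL k) → dH d ≡ h (incR k)) →
    (∀ y → y ∉ im incR → h y ∉ im dH) →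
    (∀ w → w ∈ im dH ⊎ w ∈ im h) →
    Replacement S G H
  replacement {g = g} {h} {dG} {dH} g-inj h-inj dG-inj dH-inj D-char glue fresh cover = record
    { g = g ; h = h
    ; _↝_ = λ v w → ∃[ d ] dG d ≡ v × dH d ≡ w
    ; h-inj = h-inj
    ; functional = λ { (d , q , refl) (d′ , q′ , refl) → cong dH (dG-inj (trans q (sym q′))) }
    ; injective  = λ { (d , refl , q) (d′ , refl , q′) → cong dG (dH-inj (trans q (sym q′))) }
    ; survives   = survives
    ; preserved  = preserved
    ; interface  = interface
    ; absorbed   = absorbed
    ; cover      = λ w → [ (λ (d , q) → inj₁ (dG d , d , refl , q)) , inj₂ ]′ (cover w)
    }
    where
    survives : ∀ v → (∀ x → g x ≡ v → x ∈ im incL) → ∃[ w ] ∃[ d ] dG d ≡ v × dH d ≡ w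
    survives v p =
      let d , q = Equivalence.from (D-char v) λ (x , x∉K , r) → x∉K (p x r)
      in dH d , d , q , refl

    interface : ∀ k → ∃[ d ] dG d ≡ g (incL k) × dH d ≡ h (incR k)
    interface k with survives (g (incL k)) (λ x q → k , g-inj (sym q))
    ... | _ , d , q , _ = d , q , glue d k q

    preserved : ∀ {v w x} → ∃[ d ] dG d ≡ v × dH d ≡ w → g x ≡ v → x ∈ im incL
    preserved {x = x} (d , q , _) r with ∃?-fin finite (λ k → incL k ≟L x)
    ... | yes p = p
    ... | no ¬p = contradiction (x , ¬p , r) (Equivalence.to (D-char _) (d , q))

    absorbed : ∀ {v w y} → ∃[ d ] dG d ≡ v × dH d ≡ w → h y ≡ w →
              ∃[ k ] incR k ≡ y × g (incL k) ≡ v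
    absorbed {y = y} (d , q , r) eq with ∃?-fin finite (λ k → incR k ≟R y)
    ... | no ¬p = contradiction (d , trans r (sym eq)) (fresh y ¬p)
    ... | yes (k , refl) with interface k
    ...   | d′ , q′ , r′ = k , refl ,
      trans (sym q′) (trans (cong dG (dH-inj (trans r′ (trans eq (sym r))))) q)

-- The labelling of D is eliminated. The premise of `kept` holds outside the interface and also on
-- interface nodes labelled in K; `set` covers the whole image of R, so both clauses may apply to
-- one node.
record Relabelling {S : Span} {G H A : Set} (ρ : Replacement S G H)
                   (lK : Span.K S → Maybe A) (lR : Span.R S → Maybe A)
                   (lG : G → Maybe A) (lH : H → Maybe A) : Set where
  open Span S
  open Replacement ρ
  field
    kept : ∀ {v w} → v ↝ w → (∀ k → g (incL k) ≡ v → lK k ≢ nothing) → lH w ≡ lG v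
    set  : ∀ y → lH (h y) ≡ lR y

SameOrigin : {S : Span} {G H H′ : Set} → Replacement S G H → Replacement S G H′ → H → H′ → Set
SameOrigin ρ ρ′ w w′ = (∃[ v ] v ρ.↝ w × v ρ′.↝ w′) ⊎ (∃[ y ] ρ.h y ≡ w × ρ′.h y ≡ w′)
  where
  module ρ  = Replacement ρ
  module ρ′ = Replacement ρ′

SameOrigin-sym : {S : Span} {G H H′ : Set} (ρ : Replacement S G H) (ρ′ : Replacement S G H′) →
                 ∀ {w w′} → SameOrigin ρ ρ′ w w′ → SameOrigin ρ′ ρ w′ w
SameOrigin-sym _ _ = [ (λ (v , p , q) → inj₁ (v , q , p)) , (λ (y , p , q) → inj₂ (y , q , p)) ]′

module _ {S : Span} {G H H′ : Set} (ρ : Replacement S G H) (ρ′ : Replacement S G H′)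
         (g≗g′ : ∀ x → Replacement.g ρ x ≡ Replacement.g ρ′ x) where
  open Span S
  private
    module ρ  = Replacement ρ
    module ρ′ = Replacement ρ′
    _~_ = SameOrigin ρ ρ′

  SameOrigin-total : ∀ w → ∃ (w ~_)
  SameOrigin-total w with ρ.cover w
  ... | inj₂ (y , q) = ρ′.h y , inj₂ (y , q , refl)
  ... | inj₁ (v , p) =
    map₂ (λ q → inj₁ (v , p , q))
      (ρ′.survives v λ x q → ρ.preserved p (trans (g≗g′ x) q))

  private
    -- The alternatives of `SameOrigin` overlap on the interface: a tracked item in the image of R
    -- comes from some `k`, and the other replacement tracks `k` to the same item of R.
    interface : ∀ {v w w′ y} → v ρ.↝ w → v ρ′.↝ w′ → ρ.h y ≡ w → w′ ≡ ρ′.h y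
    interface p p′ q with ρ.absorbed p q
    ... | k , refl , refl =
      ρ′.functional (subst (ρ′._↝ _) (g≗g′ (incL k)) p′) (ρ′.interface k)

  SameOrigin-functional : ∀ {w w′ w″} → w ~ w′ → w ~ w″ → w′ ≡ w″
  SameOrigin-functional (inj₁ (v , p , p′)) (inj₁ (u , q , q′)) with ρ.injective p q
  ... | refl = ρ′.functional p′ q′
  SameOrigin-functional (inj₁ (_ , p , p′)) (inj₂ (y , q , refl)) = interface p p′ q
  SameOrigin-functional (inj₂ (y , q , refl)) (inj₁ (_ , p , p′)) = sym (interface p p′ q)
  SameOrigin-functional (inj₂ (y , q , refl)) (inj₂ (y′ , q′ , refl)) =
    cong ρ′.h (ρ.h-inj (trans q (sym q′)))

  module _ {A : Set} {lK : K → Maybe A} {lR : R → Maybe A} {lG : G → Maybe A}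
           {lH : H → Maybe A} {lH′ : H′ → Maybe A} (≟G : DecidableEquality G)
           (λρ : Relabelling ρ lK lR lG lH) (λρ′ : Relabelling ρ′ lK lR lG lH′) where
    private
      module λρ  = Relabelling λρ
      module λρ′ = Relabelling λρ′

    -- On the interface the labels are compared through R, as K may leave them undefined; elsewhere
    -- both equal the label in G.
    SameOrigin-label : ∀ {w w′} → w ~ w′ → lH w ≡ lH′ w′
    SameOrigin-label (inj₂ (y , refl , refl)) = trans (λρ.set y) (sym (λρ′.set y))
    SameOrigin-label (inj₁ (v , p , p′)) with ∃?-fin finite (λ k → ≟G (ρ.g (incL k)) v)
    ... | yes (k , refl) with ρ.functional p (ρ.interface k)
    ...   | refl with ρ′.functional (subst (ρ′._↝ _) (g≗g′ (incL k)) p′) (ρ′.interface k)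
    ...     | refl = trans (λρ.set (incR k)) (sym (λρ′.set (incR k)))
    SameOrigin-label (inj₁ (v , p , p′)) | no ∉K =
      trans (λρ.kept p λ k q → contradiction (k , q) ∉K)
        (sym (λρ′.kept p′ λ k q → contradiction (k , trans (g≗g′ _) q) ∉K))

-- Node and edge parts of direct derivations, uniqueness of results

module _ (r : Rule 𝓛) where
  open Rule r
  private
    module L = TLRG L
    module R = TLRG R
    module K = Graph K
    module incL = _↪_ incL
    module incR = _↪_ incR

  nodeSpan : Span
  nodeSpan = record
    { K = K.V ; L = L.V ; R = R.V ; incL = incL.onV ; incR = incR.onV
    ; finite = K.V-fin
    ; _≟L_ = ≟-fin L.V-fin ; _≟R_ = ≟-fin R.V-fin
    }

  edgeSpan : Span
  edgeSpan = record
    { K = K.E ; L = L.E ; R = R.E ; incL = incL.onE ; incR = incR.onE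
    ; finite = K.E-fin
    ; _≟L_ = ≟-fin L.E-fin ; _≟R_ = ≟-fin R.E-fin
    }

module Derivation {r : Rule 𝓛} {G H : TLRG 𝓛} {g : graph (Rule.L r) ↪ graph G}
                  (δ : DirectDerivation r G g H) where
  open DirectDerivation δ
  private
    module G = TLRG G
    module H = TLRG H
    module K = Graph K
    module R = TLRG R
    module g = _↪_ g

  nodes : Replacement (nodeSpan r) G.V H.V
  nodes = replacement (nodeSpan r) g.injV h.injV D⊆G.injV D⊆H.injV D-nodes glueV freshV coverV

  edges : Replacement (edgeSpan r) G.E H.E
  edges = replacement (edgeSpan r) g.injE h.injE D⊆G.injE D⊆H.injE D-edges glueE freshE coverE

  module nodes = Replacement nodes
  module edges = Replacement edges

  s-track : ∀ {e f} → e edges.↝ f → G.s e nodes.↝ H.s f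
  s-track (d , refl , refl) = D.s d , sym (D⊆G.s-pres d) , sym (D⊆H.s-pres d)

  t-track : ∀ {e f} → e edges.↝ f → G.t e nodes.↝ H.t f
  t-track (d , refl , refl) = D.t d , sym (D⊆G.t-pres d) , sym (D⊆H.t-pres d)

  m-track : ∀ {e f} → e edges.↝ f → G.m e ≡ H.m f
  m-track (d , refl , refl) = trans (D⊆G.m-pres d) (sym (D⊆H.m-pres d))

  labels : Relabelling nodes K.l R.l G.l H.l
  labels = record
    { kept = λ { (d , refl , refl) K↓ →
        let q = l-keep d λ k r → K↓ k (sym r)
            a , G↓ = just-total (G.l-total (D⊆G.onV d))
        in trans (D⊆H.l-pres d (trans q G↓)) (sym G↓) }
    ; set = ↪-l {G = R} {H = H} h
    }

  roots : Relabelling nodes K.p R.p G.p H.p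
  roots = record
    { kept = λ { (d , refl , refl) K↓ →
        let q = p-keep d λ k r → K↓ k (sym r)
            a , G↓ = just-total (G.p-total (D⊆G.onV d))
        in trans (D⊆H.p-pres d (trans q G↓)) (sym G↓) }
    ; set = ↪-p {G = R} {H = H} h
    }

infix 4 _≗↪_
_≗↪_ : {G H : Graph 𝓛} → G ↪ H → G ↪ H → Set
f ≗↪ g = (∀ v → _↪_.onV f v ≡ _↪_.onV g v) × (∀ e → _↪_.onE f e ≡ _↪_.onE g e)

module _ {r : Rule 𝓛} {G : TLRG 𝓛} where

  private
    simulation : ∀ {H H′} {g g′ : graph (Rule.L r) ↪ graph G} → g ≗↪ g′ →
                 (δ : DirectDerivation r G g H) (δ′ : DirectDerivation r G g′ H′) →
                 Simulation H H′ (SameOrigin (Derivation.nodes δ) (Derivation.nodes δ′))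
                                 (SameOrigin (Derivation.edges δ) (Derivation.edges δ′))
    simulation (≗V , ≗E) δ δ′ = record
      { totalV      = SameOrigin-total δ.nodes δ′.nodes ≗V
      ; totalE      = SameOrigin-total δ.edges δ′.edges ≗E
      ; functionalV = SameOrigin-functional δ.nodes δ′.nodes ≗V
      ; functionalE = SameOrigin-functional δ.edges δ′.edges ≗E
      ; s-compat = λ { (inj₁ (e , p , p′)) → inj₁ (_ , δ.s-track p , δ′.s-track p′)
                     ; (inj₂ (e , refl , refl)) →
                         inj₂ (_ , sym (δ.h.s-pres e) , sym (δ′.h.s-pres e)) }
      ; t-compat = λ { (inj₁ (e , p , p′)) → inj₁ (_ , δ.t-track p , δ′.t-track p′)
                     ; (inj₂ (e , refl , refl)) →
                         inj₂ (_ , sym (δ.h.t-pres e) , sym (δ′.h.t-pres e)) }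
      ; m-compat = λ { (inj₁ (e , p , p′)) → trans (sym (δ.m-track p)) (δ′.m-track p′)
                     ; (inj₂ (e , refl , refl)) → trans (δ.h.m-pres e) (sym (δ′.h.m-pres e)) }
      ; l-compat = SameOrigin-label δ.nodes δ′.nodes ≗V (≟-fin (TLRG.V-fin G)) δ.labels δ′.labels
      ; p-compat = SameOrigin-label δ.nodes δ′.nodes ≗V (≟-fin (TLRG.V-fin G)) δ.roots δ′.roots
      }
      where
      module δ where
        open Derivation δ public
        open DirectDerivation δ public using (module h)
      module δ′ where
        open Derivation δ′ public
        open DirectDerivation δ′ public using (module h)

  -- Whether an item is deleted, kept or created is determined by the rule and the maps of the
  -- match, so items of equal origin correspond in both directions.
  result-unique : ∀ {H H′} {g g′ : graph (Rule.L r) ↪ graph G} → g ≗↪ g′ →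
                  DirectDerivation r G g H → DirectDerivation r G g′ H′ → graph H ≅ graph H′
  result-unique {H} {H′} g≗g′@(≗V , ≗E) δ δ′ = simulations⇒≅ {G = H} {H = H′}
    (simulation g≗g′ δ δ′) (simulation ((λ v → sym (≗V v)) , (λ e → sym (≗E e))) δ′ δ)
    (SameOrigin-sym δ.nodes δ′.nodes) (SameOrigin-sym δ.edges δ′.edges)
    (SameOrigin-sym δ′.nodes δ.nodes) (SameOrigin-sym δ′.edges δ.edges)
    where
    module δ = Derivation δ
    module δ′ = Derivation δ′

-- Parallel independence

-- A local Church-Rosser square: `τ₂` is the second replacement after `ρ₁`, and `τ₁` is the first
-- one after `ρ₂`. The residual matches are the original ones followed along the tracks.
record Diamond (S₁ S₂ : Span) (G H₁ H₂ M₁ M₂ : Set) : Set₁ where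
  field
    ρ₁ : Replacement S₁ G H₁
    ρ₂ : Replacement S₂ G H₂
    τ₂ : Replacement S₂ H₁ M₁
    τ₁ : Replacement S₁ H₂ M₂
  module S₁ = Span S₁
  module S₂ = Span S₂
  module ρ₁ = Replacement ρ₁
  module ρ₂ = Replacement ρ₂
  module τ₁ = Replacement τ₁
  module τ₂ = Replacement τ₂
  field
    residual₁ : ∀ x → ρ₁.g x ρ₂.↝ τ₁.g x
    residual₂ : ∀ x → ρ₂.g x ρ₁.↝ τ₂.g x
    independent : ∀ x₁ x₂ → ρ₁.g x₁ ≡ ρ₂.g x₂ → x₁ ∈ im S₁.incL × x₂ ∈ im S₂.incL

module _ {S₁ S₂ G H₁ H₂ M₁ M₂} (ρ₁ : Replacement S₁ G H₁) (ρ₂ : Replacement S₂ G H₂)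
         (τ₂ : Replacement S₂ H₁ M₁) (τ₁ : Replacement S₁ H₂ M₂) where
  private
    module ρ₁ = Replacement ρ₁
    module ρ₂ = Replacement ρ₂
    module τ₁ = Replacement τ₁
    module τ₂ = Replacement τ₂

  -- Items that survive both replacements, come from `R₁`, or come from `R₂`. The cases overlap on
  -- the interfaces, so functionality has to reconcile every pair of them.
  data Confluent (m₁ : M₁) (m₂ : M₂) : Set where
    old  : ∀ {v a b} → v ρ₁.↝ a → a τ₂.↝ m₁ → v ρ₂.↝ b → b τ₁.↝ m₂ → Confluent m₁ m₂
    new₁ : ∀ {y} → ρ₁.h y τ₂.↝ m₁ → τ₁.h y ≡ m₂ → Confluent m₁ m₂
    new₂ : ∀ {y} → τ₂.h y ≡ m₁ → ρ₂.h y τ₁.↝ m₂ → Confluent m₁ m₂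

Confluent-mirror :
  ∀ {S₁ S₂ G H₁ H₂ M₁ M₂} {ρ₁ : Replacement S₁ G H₁} {ρ₂ : Replacement S₂ G H₂}
  {τ₂ : Replacement S₂ H₁ M₁} {τ₁ : Replacement S₁ H₂ M₂} {m₁ m₂} →
  Confluent ρ₁ ρ₂ τ₂ τ₁ m₁ m₂ → Confluent ρ₂ ρ₁ τ₁ τ₂ m₂ m₁
Confluent-mirror (old p p′ q q′) = old q q′ p p′
Confluent-mirror (new₁ p q)      = new₂ q p
Confluent-mirror (new₂ p q)      = new₁ q p

module _ {S₁ S₂ G H₁ H₂ M₁ M₂} (◇ : Diamond S₁ S₂ G H₁ H₂ M₁ M₂) where
  open Diamond ◇
  private _~_ = Confluent ρ₁ ρ₂ τ₂ τ₁

  private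
    -- A residual match hits only items tracked from `G`, and these meet the image of `R₁` in the
    -- interface alone.
    meet : ∀ {y x} → τ₂.g x ≡ ρ₁.h y →
           ∃[ k ] S₁.incR k ≡ y × ρ₁.g (S₁.incL k) ≡ ρ₂.g x
    meet q = ρ₁.absorbed (residual₂ _) (sym q)

    old≡new₁ : ∀ {v a b m₁ m₂ y} → v ρ₁.↝ a → a τ₂.↝ m₁ → v ρ₂.↝ b → b τ₁.↝ m₂ →
               ρ₁.h y τ₂.↝ m₁ → m₂ ≡ τ₁.h y
    old≡new₁ p p′ q q′ r with τ₂.injective p′ r
    ... | refl with ρ₁.absorbed p refl
    ...   | k , refl , refl with ρ₂.functional q (residual₁ _)
    ...     | refl = τ₁.functional q′ (τ₁.interface k)

    old≡new₂ : ∀ {v a b m₁ m₂ m₂′ y} → v ρ₁.↝ a → a τ₂.↝ m₁ → v ρ₂.↝ b → b τ₁.↝ m₂ →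
               τ₂.h y ≡ m₁ → ρ₂.h y τ₁.↝ m₂′ → m₂ ≡ m₂′
    old≡new₂ p p′ q q′ r r′ with τ₂.absorbed p′ r
    ... | k , refl , refl with ρ₁.injective p (residual₂ _)
    ...   | refl with ρ₂.functional q (ρ₂.interface k)
    ...     | refl = τ₁.functional q′ r′

    -- An item in the images of both right-hand sides lies in both interfaces, so it is also an old
    -- item.
    new₁≡new₂ : ∀ {m₁ m₂ y y′} → ρ₁.h y τ₂.↝ m₁ → τ₂.h y′ ≡ m₁ → ρ₂.h y′ τ₁.↝ m₂ → τ₁.h y ≡ m₂
    new₁≡new₂ p r r′ with τ₂.absorbed p r
    ... | k , refl , q with meet q
    ...   | k₁ , refl , _ =
      old≡new₂ (ρ₁.interface k₁) p (residual₁ _) (τ₁.interface k₁) r r′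

  Confluent-functional : ∀ {m₁ m₂ m₂′} → m₁ ~ m₂ → m₁ ~ m₂′ → m₂ ≡ m₂′
  Confluent-functional (old p p′ q q′) (old r r′ s s′) with τ₂.injective p′ r′
  ... | refl with ρ₁.injective p r
  ...   | refl with ρ₂.functional q s
  ...     | refl = τ₁.functional q′ s′
  Confluent-functional (old p p′ q q′) (new₁ r refl)   = old≡new₁ p p′ q q′ r
  Confluent-functional (old p p′ q q′) (new₂ r r′)     = old≡new₂ p p′ q q′ r r′
  Confluent-functional (new₁ r refl)   (old p p′ q q′) = sym (old≡new₁ p p′ q q′ r)
  Confluent-functional (new₁ r refl)   (new₁ s refl)   = cong τ₁.h (ρ₁.h-inj (τ₂.injective r s))
  Confluent-functional (new₁ r refl)   (new₂ s s′)     = new₁≡new₂ r s s′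
  Confluent-functional (new₂ r r′)     (old p p′ q q′) = sym (old≡new₂ p p′ q q′ r r′)
  Confluent-functional (new₂ s s′)     (new₁ r refl)   = sym (new₁≡new₂ r s s′)
  Confluent-functional (new₂ r r′)     (new₂ s s′) with τ₂.h-inj (trans r (sym s))
  ... | refl = τ₁.functional r′ s′

  -- Survival has to be moved to the other order. If the residual of the first match hits an item of
  -- `R₂`, then the two matches overlap in `G`, and independence puts the overlap into the
  -- interface.
  Confluent-total : ∀ m₁ → ∃ (m₁ ~_)
  Confluent-total m₁ with τ₂.cover m₁
  ... | inj₂ (y , refl) =
    map₂ (new₂ refl) (τ₁.survives (ρ₂.h y) λ x q → survives x q)
    where
    survives : ∀ x → τ₁.g x ≡ ρ₂.h y → x ∈ im S₁.incL
    survives x q with ρ₂.absorbed (residual₁ x) (sym q)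
    ... | k , _ , eq = proj₁ (independent _ _ (sym eq))
  ... | inj₁ (a , p′) with ρ₁.cover a
  ...   | inj₂ (y , refl) = τ₁.h y , new₁ p′ refl
  ...   | inj₁ (v , p) with ρ₂.survives v
      (λ where x refl → τ₂.preserved p′ (ρ₁.functional (residual₂ x) p))
  ...     | b , q = map₂ (old p p′ q) (τ₁.survives b λ where
        x refl → ρ₁.preserved p (ρ₂.injective (residual₁ x) q))

  module _ {A : Set} {lK₁ : S₁.K → Maybe A} {lR₁ : S₁.R → Maybe A}
           {lK₂ : S₂.K → Maybe A} {lR₂ : S₂.R → Maybe A}
           {lG : G → Maybe A} {lH₁ : H₁ → Maybe A} {lH₂ : H₂ → Maybe A}
           {lM₁ : M₁ → Maybe A} {lM₂ : M₂ → Maybe A} (≟G : DecidableEquality G)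
           (λρ₁ : Relabelling ρ₁ lK₁ lR₁ lG lH₁) (λρ₂ : Relabelling ρ₂ lK₂ lR₂ lG lH₂)
           (λτ₂ : Relabelling τ₂ lK₂ lR₂ lH₁ lM₁) (λτ₁ : Relabelling τ₁ lK₁ lR₁ lH₂ lM₂)
           (no-conflict : ∀ k₁ k₂ → ρ₁.g (S₁.incL k₁) ≡ ρ₂.g (S₂.incL k₂) →
                          lK₁ k₁ ≢ nothing × lK₂ k₂ ≢ nothing) where
    private
      module λρ₁ = Relabelling λρ₁
      module λρ₂ = Relabelling λρ₂
      module λτ₁ = Relabelling λτ₁
      module λτ₂ = Relabelling λτ₂

      -- A label written by the first rule outlasts `τ₂`: wherever the interface of the second rule
      -- meets it, the label is defined in `K₂` and hence kept.
      new₁-label : ∀ {m₁ y} → ρ₁.h y τ₂.↝ m₁ → lM₁ m₁ ≡ lM₂ (τ₁.h y)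
      new₁-label {y = y} p = trans
        (λτ₂.kept p λ k q → let k₁ , _ , eq = meet q in proj₂ (no-conflict k₁ k eq))
        (trans (λρ₁.set y) (sym (λτ₁.set y)))

      new₂-label : ∀ {m₂ y} → ρ₂.h y τ₁.↝ m₂ → lM₁ (τ₂.h y) ≡ lM₂ m₂
      new₂-label {y = y} p = trans (trans (λτ₂.set y) (sym (λρ₂.set y))) (sym
        (λτ₁.kept p λ k q → let k₂ , _ , eq = ρ₂.absorbed (residual₁ _) (sym q)
                            in proj₁ (no-conflict k k₂ (sym eq))))

    -- An old item of an interface is also a new item of that rule; outside both interfaces all four
    -- replacements keep the label of `G`.
    Confluent-label : ∀ {m₁ m₂} → m₁ ~ m₂ → lM₁ m₁ ≡ lM₂ m₂
    Confluent-label (new₁ p refl) = new₁-label p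
    Confluent-label (new₂ refl p) = new₂-label p
    Confluent-label (old {v} p p′ q q′)
      with ∃?-fin S₁.finite (λ k → ≟G (ρ₁.g (S₁.incL k)) v)
         | ∃?-fin S₂.finite (λ k → ≟G (ρ₂.g (S₂.incL k)) v)
    ... | yes (k , refl) | _ with ρ₁.functional p (ρ₁.interface k)
    ...   | refl with old≡new₁ p p′ q q′ p′
    ...     | refl = new₁-label p′
    Confluent-label (old {v} p p′ q q′) | no _ | yes (k , refl)
      with ρ₂.functional q (ρ₂.interface k) | ρ₁.functional p (residual₂ _)
    ...   | refl | refl with τ₂.functional p′ (τ₂.interface k)
    ...     | refl = new₂-label q′
    Confluent-label (old {v} p p′ q q′) | no ∉K₁ | no ∉K₂ = begin
      lM₁ _ ≡⟨ λτ₂.kept p′ (λ where k refl → contradiction (k , ρ₁.injective (residual₂ _) p) ∉K₂) ⟩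
      lH₁ _ ≡⟨ λρ₁.kept p (λ k q → contradiction (k , q) ∉K₁) ⟩
      lG v  ≡⟨ λρ₂.kept q (λ k q → contradiction (k , q) ∉K₂) ⟨
      lH₂ _ ≡⟨ λτ₁.kept q′ (λ where k refl → contradiction (k , ρ₂.injective (residual₁ _) q) ∉K₁) ⟨
      lM₂ _ ∎
      where open ≡-Reasoning

-- Extension of graphs and derivations by a context

-- A graph with dangling edge ends: these point to B, whose elements become
-- nodes of the graph that the context is attached to.
record Context (𝓛 : LabelAlphabet) (B : Set) : Set₁ where
  open LabelAlphabet 𝓛
  field
    V E     : Set
    |V| |E| : ℕ
    V-fin   : V ↔ Fin |V|
    E-fin   : E ↔ Fin |E|
    s t     : E → B ⊎ V
    l       : V → Maybe LV
    m       : E → LE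
    p       : V → Maybe Bool
    l-total : ∀ v → Is-just (l v)
    p-total : ∀ v → Is-just (p v)

⊎-fin : {A B : Set} {m n : ℕ} → A ↔ Fin m → B ↔ Fin n → (A ⊎ B) ↔ Fin (m ℕ.+ n)
⊎-fin i j = ↔-trans (i ⊎-↔ j) (↔-sym +↔⊎)

map-id-injective : {A B C : Set} {f : A → B} → Injective _≡_ _≡_ f →
                   Injective _≡_ _≡_ (Sum.map {B = C} f id)
map-id-injective f-inj {inj₁ _} {inj₁ _} q    = cong inj₁ (f-inj (inj₁-injective q))
map-id-injective f-inj {inj₂ _} {inj₂ _} refl = refl

module _ {L K G D C : Set} {incL : K → L} {g : L → G} {dG : D → G} where

  extend-survivors :
    (∀ v → v ∈ im dG ⇔ (¬ (∃[ x ] x ∉ im incL × g x ≡ v))) →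
    ∀ w → w ∈ im (Sum.map {B = C} dG id) ⇔ (¬ (∃[ x ] x ∉ im incL × inj₁ (g x) ≡ w))
  extend-survivors D-char (inj₁ v) = mk⇔
    (λ { (inj₁ d , refl) (x , x∉K , q) →
           Equivalence.to (D-char v) (d , refl) (x , x∉K , inj₁-injective q) })
    (λ ¬del → let d , q = Equivalence.from (D-char v) λ (x , x∉K , q) → ¬del (x , x∉K , cong inj₁ q)
              in inj₁ d , cong inj₁ q)
  extend-survivors D-char (inj₂ c) = mk⇔ (λ { _ (_ , _ , ()) }) (λ _ → inj₂ c , refl)

module _ {B : Set} (C : Context 𝓛 B) where
  private module C = Context C

  -- The map `b` may identify attachment points, so B can consist of nodes paired with evidence
  -- about them.
  extendᴳ : (X : Graph 𝓛) → (B → Graph.V X) → Graph 𝓛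
  extendᴳ X b = record
    { V = X.V ⊎ C.V ; E = X.E ⊎ C.E
    ; |V| = X.|V| ℕ.+ C.|V| ; |E| = X.|E| ℕ.+ C.|E|
    ; V-fin = ⊎-fin X.V-fin C.V-fin ; E-fin = ⊎-fin X.E-fin C.E-fin
    ; s = [ inj₁ ∘ X.s , Sum.map b id ∘ C.s ]
    ; t = [ inj₁ ∘ X.t , Sum.map b id ∘ C.t ]
    ; l = [ X.l , C.l ] ; m = [ X.m , C.m ] ; p = [ X.p , C.p ]
    }
    where module X = Graph X

  extend : (X : TLRG 𝓛) → (B → TLRG.V X) → TLRG 𝓛
  extend X b = record
    { graph   = extendᴳ (graph X) b
    ; l-total = λ { (inj₁ v) → TLRG.l-total X v ; (inj₂ c) → C.l-total c }
    ; p-total = λ { (inj₁ v) → TLRG.p-total X v ; (inj₂ c) → C.p-total c }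
    }

  extend-inc : (X : Graph 𝓛) (b : B → Graph.V X) → X ↪ extendᴳ X b
  extend-inc X b = record
    { morphism = record
      { onV = inj₁ ; onE = inj₁
      ; s-pres = λ _ → refl ; t-pres = λ _ → refl ; m-pres = λ _ → refl
      ; l-pres = λ _ q → q ; p-pres = λ _ q → q
      }
    ; injV = inj₁-injective
    ; injE = inj₁-injective
    }

  extend-morphism : {X Y : Graph 𝓛} (f : Morphism X Y) {b : B → Graph.V X} {b′ : B → Graph.V Y} →
                    (∀ i → Morphism.onV f (b i) ≡ b′ i) → Morphism (extendᴳ X b) (extendᴳ Y b′)
  extend-morphism f {b} {b′} fb≗b′ = record
    { onV = Sum.map f.onV id
    ; onE = Sum.map f.onE id
    ; s-pres = λ { (inj₁ e) → cong inj₁ (f.s-pres e) ; (inj₂ c) → attach (C.s c) }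
    ; t-pres = λ { (inj₁ e) → cong inj₁ (f.t-pres e) ; (inj₂ c) → attach (C.t c) }
    ; m-pres = λ { (inj₁ e) → f.m-pres e ; (inj₂ c) → refl }
    ; l-pres = λ { (inj₁ v) → f.l-pres v ; (inj₂ c) q → q }
    ; p-pres = λ { (inj₁ v) → f.p-pres v ; (inj₂ c) q → q }
    }
    where
    module f = Morphism f
    attach : ∀ z → Sum.map b′ id z ≡ Sum.map f.onV id (Sum.map b id z)
    attach (inj₁ i) = cong inj₁ (sym (fb≗b′ i))
    attach (inj₂ c) = refl

  extend-↪ : {X Y : Graph 𝓛} (f : X ↪ Y) {b : B → Graph.V X} {b′ : B → Graph.V Y} →
             (∀ i → _↪_.onV f (b i) ≡ b′ i) → extendᴳ X b ↪ extendᴳ Y b′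
  extend-↪ f fb≗b′ = record
    { morphism = extend-morphism f.morphism fb≗b′
    ; injV = map-id-injective f.injV
    ; injE = map-id-injective f.injE
    }
    where module f = _↪_ f

  extend-≅ : {X Y : Graph 𝓛} (i : X ≅ Y) {b : B → Graph.V X} {b′ : B → Graph.V Y} →
             (∀ j → Morphism.onV (_≅_.to i) (b j) ≡ b′ j) → extendᴳ X b ≅ extendᴳ Y b′
  extend-≅ i ib≗b′ = record
    { to   = extend-morphism to ib≗b′
    ; from = extend-morphism from
        (λ j → trans (cong (Morphism.onV from) (sym (ib≗b′ j))) (from-toV _))
    ; from-toV = λ { (inj₁ v) → cong inj₁ (from-toV v) ; (inj₂ c) → refl }
    ; from-toE = λ { (inj₁ e) → cong inj₁ (from-toE e) ; (inj₂ c) → refl }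
    ; to-fromV = λ { (inj₁ v) → cong inj₁ (to-fromV v) ; (inj₂ c) → refl }
    ; to-fromE = λ { (inj₁ e) → cong inj₁ (to-fromE e) ; (inj₂ c) → refl }
    }
    where open _≅_ i

  -- `tracked` provides a node of D for every attachment point, so the context also fits onto D. As
  -- these nodes are preserved, no context edge is incident to a deleted node.
  extend-derivation :
    {r : Rule 𝓛} {X Y : TLRG 𝓛} {g : graph (Rule.L r) ↪ graph X} (δ : DirectDerivation r X g Y)
    (b : B → TLRG.V X) (b′ : B → TLRG.V Y) → (∀ i → Replacement._↝_ (Derivation.nodes δ) (b i) (b′ i)) →
    DirectDerivation r (extend X b) (extend-inc (graph X) b ∘↪ g) (extend Y b′)
  extend-derivation {X = X} {Y} {g} δ b b′ tracked = record
    { dangling = dangling′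
    ; D        = extendᴳ D (proj₁ ∘ tracked)
    ; D⊆G      = extend-↪ D⊆G (proj₁ ∘ proj₂ ∘ tracked)
    ; D-nodes  = extend-survivors D-nodes
    ; D-edges  = extend-survivors D-edges
    ; l-undef  = λ { (inj₁ d) k q → l-undef d k (inj₁-injective q) }
    ; l-keep   = λ { (inj₁ d) K↓ → l-keep d λ k q → K↓ k (cong inj₁ q) ; (inj₂ c) _ → refl }
    ; p-undef  = λ { (inj₁ d) k q → p-undef d k (inj₁-injective q) }
    ; p-keep   = λ { (inj₁ d) K↓ → p-keep d λ k q → K↓ k (cong inj₁ q) ; (inj₂ c) _ → refl }
    ; D⊆H      = extend-↪ D⊆H (proj₂ ∘ proj₂ ∘ tracked)
    ; h        = extend-inc (graph Y) b′ ∘↪ h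
    ; glueV    = λ { (inj₁ d) k q → cong inj₁ (glueV d k (inj₁-injective q)) }
    ; glueE    = λ { (inj₁ d) k q → cong inj₁ (glueE d k (inj₁-injective q)) }
    ; freshV   = λ { y y∉K (inj₁ d , q) → freshV y y∉K (d , inj₁-injective q) }
    ; freshE   = λ { y y∉K (inj₁ d , q) → freshE y y∉K (d , inj₁-injective q) }
    ; coverV   = λ { (inj₁ w) → Sum.map (λ (d , q) → inj₁ d , cong inj₁ q)
                                        (λ (y , q) → y , cong inj₁ q) (coverV w)
                   ; (inj₂ c) → inj₁ (inj₂ c , refl) }
    ; coverE   = λ { (inj₁ e) → Sum.map (λ (d , q) → inj₁ d , cong inj₁ q)
                                        (λ (y , q) → y , cong inj₁ q) (coverE e)
                   ; (inj₂ c) → inj₁ (inj₂ c , refl) }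
    }
    where
    open DirectDerivation δ
    open Derivation δ using (module nodes)
    module g = _↪_ g
    module incL = _↪_ incL

    attach : ∀ z x → x ∉ im incL.onV → Sum.map b id z ≢ inj₁ (g.onV x)
    attach (inj₁ i) x x∉K q = x∉K (nodes.preserved (tracked i) (sym (inj₁-injective q)))

    dangling′ : ∀ e → e ∉ im (inj₁ ∘ g.onE) → ∀ x → x ∉ im incL.onV →
                (Graph.s (extendᴳ (graph X) b) e ≢ inj₁ (g.onV x)) ×
                (Graph.t (extendᴳ (graph X) b) e ≢ inj₁ (g.onV x))
    dangling′ (inj₁ e) e∉g x x∉K =
      let s≢ , t≢ = dangling e (λ (e′ , q) → e∉g (e′ , cong inj₁ q)) x x∉K
      in s≢ ∘ inj₁-injective , t≢ ∘ inj₁-injective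
    dangling′ (inj₂ c) _ x x∉K = attach (C.s c) x x∉K , attach (C.t c) x x∉K

  -- The track supplies the attachment map at every intermediate graph.
  extend-steps : {T : R-GTSystem 𝓛} {X Y : TLRG 𝓛} (σ : Steps T X Y)
                 (b : B → TLRG.V X) (b′ : B → TLRG.V Y) → (∀ i → track* σ (b i) (b′ i)) →
                 Steps T (extend X b) (extend Y b′)
  extend-steps (done i) b b′ tracked = done (extend-≅ i tracked)
  extend-steps {X = X} (π ◅ σ) b b′ tracked = record
    { index = index
    ; match = extend-inc (graph X) b ∘↪ match
    ; derivation = extend-derivation derivation b (proj₁ ∘ tracked) (proj₁ ∘ proj₂ ∘ tracked)
    } ◅ extend-steps σ (proj₁ ∘ tracked) b′ (proj₂ ∘ proj₂ ∘ tracked)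
    where open Step π

-- The complement of an embedded graph as a context

module _ {X G : TLRG 𝓛} (f : graph X ↪ graph G) {B : Set} (b : B → TLRG.V X) where
  private
    module X = TLRG X
    module G = TLRG G
    open module f = _↪_ f using (onV; onE)

  module _ (boundary : ∀ e → e ∉ im onE → ∀ x → G.s e ≡ onV x ⊎ G.t e ≡ onV x → x ∈ im b) where
    private
      OutV = Refinement G.V (_∉ im onV)
      OutE = Refinement G.E (_∉ im onE)

      inV? : Decidable (im onV)
      inV? = im? X.V-fin G.V-fin onV

      inE? : Decidable (im onE)
      inE? = im? X.E-fin G.E-fin onE

      locate : B ⊎ OutV → G.V
      locate = [ onV ∘ b , value ]′

      -- An endpoint inside X is replaced by the name in B that the boundary condition provides; any
      -- other endpoint is itself a context node.
      attach : ∀ v → (∀ x → v ≡ onV x → x ∈ im b) → ∃[ z ] v ≡ locate z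
      attach v v∈B with inV? v
      ... | no ¬p = inj₂ (v , irr ¬p) , refl
      ... | yes (x , refl) with v∈B x refl
      ...   | i , refl = inj₁ i , refl

      source : (e : OutE) → ∃[ z ] G.s (value e) ≡ locate z
      source (e , irr ∉) = attach (G.s e) λ x q → boundary e (¬-recompute ∉) x (inj₁ q)

      target : (e : OutE) → ∃[ z ] G.t (value e) ≡ locate z
      target (e , irr ∉) = attach (G.t e) λ x q → boundary e (¬-recompute ∉) x (inj₂ q)

    complement : Context 𝓛 B
    complement = record
      { V = OutV ; E = OutE
      ; V-fin = proj₂ (Refinement-finite G.V-fin (¬? ∘ inV?))
      ; E-fin = proj₂ (Refinement-finite G.E-fin (¬? ∘ inE?))
      ; s = proj₁ ∘ source ; t = proj₁ ∘ target
      ; l = G.l ∘ value ; m = G.m ∘ value ; p = G.p ∘ value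
      ; l-total = G.l-total ∘ value
      ; p-total = G.p-total ∘ value
      }

    private
      union : graph (extend complement X b) ↪ graph G
      union = record
        { morphism = record
          { onV = [ onV , value ]′
          ; onE = [ onE , value ]′
          ; s-pres = λ { (inj₁ e) → f.s-pres e
                       ; (inj₂ e) → trans (proj₂ (source e)) (copair (proj₁ (source e))) }
          ; t-pres = λ { (inj₁ e) → f.t-pres e
                       ; (inj₂ e) → trans (proj₂ (target e)) (copair (proj₁ (target e))) }
          ; m-pres = λ { (inj₁ e) → f.m-pres e ; (inj₂ _) → refl }
          ; l-pres = λ { (inj₁ v) → f.l-pres v ; (inj₂ _) q → q }
          ; p-pres = λ { (inj₁ v) → f.p-pres v ; (inj₂ _) q → q }
          }
        ; injV = copair-injective f.injV
        ; injE = copair-injective f.injE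
        }
        where
        copair : ∀ z → locate z ≡ [ onV , value ]′ (Sum.map b id z)
        copair (inj₁ _) = refl
        copair (inj₂ _) = refl

        copair-injective : {A A′ : Set} {f : A → A′} → Injective _≡_ _≡_ f →
                           Injective _≡_ _≡_ [ f , value {P = _∉ im f} ]′
        copair-injective f-inj {inj₁ _} {inj₁ _} q = cong inj₁ (f-inj q)
        copair-injective f-inj {inj₁ x} {inj₂ (_ , irr ∉)} q = contradiction (x , q) (¬-recompute ∉)
        copair-injective f-inj {inj₂ (_ , irr ∉)} {inj₁ x} q = contradiction (x , sym q) (¬-recompute ∉)
        copair-injective f-inj {inj₂ _} {inj₂ _} q = cong inj₂ (value-injective q)

    complement-≅ : graph (extend complement X b) ≅ graph G
    complement-≅ = bijective⇒≅ {G = extend complement X b} {H = G} union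
      (λ v → surj inV? v) (λ e → surj inE? e)
      where
      surj : {A A′ : Set} {f : A → A′} → Decidable (im f) → ∀ v →
             v ∈ im [ f , value {P = _∉ im f} ]′
      surj im-f? v with im-f? v
      ... | yes (x , q) = inj₁ x , q
      ... | no ¬p       = inj₂ (v , irr ¬p) , refl

-- Transport and existence of direct derivations

-- Only the embedding of D into the start graph changes; D and the result stay literally the same.
transport-derivation :
  {r : Rule 𝓛} {G G′ H : TLRG 𝓛} {g : graph (Rule.L r) ↪ graph G} (i : graph G ≅ graph G′)
  (g′ : graph (Rule.L r) ↪ graph G′) → ≅⇒↪ i ∘↪ g ≗↪ g′ →
  DirectDerivation r G g H → DirectDerivation r G′ g′ H
transport-derivation {r = r} {G} {G′} {g = g} i g′ (≗V , ≗E) δ = record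
  { dangling = λ e e∉g′ x x∉K →
      let s≢ , t≢ = dangling (from.onE e)
            (λ (e′ , q) → e∉g′ (e′ , trans (sym (≗E e′)) (trans (cong to.onE q) (to-fromE e)))) x x∉K
      in (λ q → s≢ (trans (from.s-pres e) (trans (cong from.onV q) (from-g′ x))))
       , (λ q → t≢ (trans (from.t-pres e) (trans (cong from.onV q) (from-g′ x))))
  ; D = D
  ; D⊆G = ≅⇒↪ i ∘↪ D⊆G
  ; D-nodes = transport-survivors to.onV from.onV to-fromV from-toV ≗V D-nodes
  ; D-edges = transport-survivors to.onE from.onE to-fromE from-toE ≗E D-edges
  ; l-undef = λ d k q → l-undef d k (backV q)
  ; l-keep  = λ d K↓ → trans (l-keep d λ k q → K↓ k (trans (cong to.onV q) (≗V _)))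
                             (sym (↪-l {G = G} {H = G′} (≅⇒↪ i) _))
  ; p-undef = λ d k q → p-undef d k (backV q)
  ; p-keep  = λ d K↓ → trans (p-keep d λ k q → K↓ k (trans (cong to.onV q) (≗V _)))
                             (sym (↪-p {G = G} {H = G′} (≅⇒↪ i) _))
  ; D⊆H = D⊆H
  ; h = h
  ; glueV = λ d k q → glueV d k (backV q)
  ; glueE = λ d k q → glueE d k (_↪_.injE (≅⇒↪ i) (trans q (sym (≗E _))))
  ; freshV = freshV ; freshE = freshE ; coverV = coverV ; coverE = coverE
  }
  where
  open DirectDerivation δ
  open _≅_ i
  module to = Morphism to
  module from = Morphism from

  from-g′ : ∀ x → from.onV (_↪_.onV g′ x) ≡ _↪_.onV g x
  from-g′ x = trans (cong from.onV (sym (≗V x))) (from-toV _)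

  backV : ∀ {v x} → to.onV v ≡ _↪_.onV g′ x → v ≡ _↪_.onV g x
  backV q = _↪_.injV (≅⇒↪ i) (trans q (sym (≗V _)))

  transport-survivors :
    {K L D V V′ : Set} {incL : K → L} {dG : D → V} {g : L → V} {g′ : L → V′}
    (to : V → V′) (from : V′ → V) → (∀ v → to (from v) ≡ v) → (∀ v → from (to v) ≡ v) →
    (∀ x → to (g x) ≡ g′ x) →
    (∀ v → v ∈ im dG ⇔ (¬ (∃[ x ] x ∉ im incL × g x ≡ v))) →
    ∀ v → v ∈ im (to ∘ dG) ⇔ (¬ (∃[ x ] x ∉ im incL × g′ x ≡ v))
  transport-survivors to from to-from from-to ≗ D-char v = mk⇔
    (λ { (d , refl) (x , x∉K , q) → Equivalence.to (D-char _) (d , refl)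
           (x , x∉K , trans (sym (from-to _)) (trans (cong from (trans (≗ x) q)) (from-to _))) })
    (λ ¬del → let d , q = Equivalence.from (D-char (from v)) λ (x , x∉K , q) →
                            ¬del (x , x∉K , trans (sym (≗ x)) (trans (cong to q) (to-from v)))
              in d , trans (cong to q) (to-from v))

↪-refl : {G : Graph 𝓛} → G ↪ G
↪-refl = ≅⇒↪ ≅-refl

-- The derivation without surroundings, with K as intermediate graph, from which `derivation-exists`
-- obtains others by extension.
rule-derivation : (r : Rule 𝓛) → DirectDerivation r (Rule.L r) ↪-refl (Rule.R r)
rule-derivation r = record
  { dangling = λ e e∉L → contradiction (e , refl) e∉L
  ; D = K
  ; D⊆G = incL
  ; D-nodes = survivors (im? K.V-fin L.V-fin (_↪_.onV incL))
  ; D-edges = survivors (im? K.E-fin L.E-fin (_↪_.onE incL))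
  ; l-undef = λ d k q K↑ → trans (cong K.l (_↪_.injV incL q)) K↑
  ; l-keep  = λ d K↓ → keep (K.l d) (K↓ d refl) (_↪_.l-pres incL d)
  ; p-undef = λ d k q K↑ → trans (cong K.p (_↪_.injV incL q)) K↑
  ; p-keep  = λ d K↓ → keep (K.p d) (K↓ d refl) (_↪_.p-pres incL d)
  ; D⊆H = incR
  ; h = ↪-refl
  ; glueV = λ d k q → cong (_↪_.onV incR) (_↪_.injV incL q)
  ; glueE = λ d k q → cong (_↪_.onE incR) (_↪_.injE incL q)
  ; freshV = λ y y∉K → y∉K
  ; freshE = λ y y∉K → y∉K
  ; coverV = λ w → inj₂ (w , refl)
  ; coverE = λ e → inj₂ (e , refl)
  }
  where
  open Rule r
  module K = Graph K
  module L = TLRG L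

  keep : {A : Set} (x : Maybe A) {y : Maybe A} → x ≢ nothing → (∀ {a} → x ≡ just a → y ≡ just a) → x ≡ y
  keep (just _) _  x⊆y = sym (x⊆y refl)
  keep nothing  x↓ _   = contradiction refl x↓

  survivors : {A A′ : Set} {inc : A → A′} → Decidable (im inc) →
              ∀ v → v ∈ im inc ⇔ (¬ (∃[ x ] x ∉ im inc × x ≡ v))
  survivors im-inc? v = mk⇔
    (λ { v∈K (x , x∉K , refl) → x∉K v∈K })
    (λ ¬del → decidable-stable (im-inc? v) λ v∉K → ¬del (v , v∉K , refl))

Dangling : (r : Rule 𝓛) {G : Graph 𝓛} → graph (Rule.L r) ↪ G → Set
Dangling r {G} g = ∀ e → e ∉ im g.onE → ∀ x → x ∉ im (_↪_.onV incL) →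
                   (G.s e ≢ g.onV x) × (G.t e ≢ g.onV x)
  where
  open Rule r
  module g = _↪_ g
  module G = Graph G

Dangling⇒interface : (r : Rule 𝓛) {G : Graph 𝓛} (g : graph (Rule.L r) ↪ G) → Dangling r g →
  ∀ e → e ∉ im (_↪_.onE g) → ∀ x → Graph.s G e ≡ _↪_.onV g x ⊎ Graph.t G e ≡ _↪_.onV g x →
  x ∈ im (_↪_.onV (Rule.incL r))
Dangling⇒interface r g dangling e e∉g x q = decidable-stable
  (im? (Graph.V-fin K) (TLRG.V-fin L) (_↪_.onV incL) x) λ x∉K →
    let s≢ , t≢ = dangling e e∉g x x∉K in [ s≢ , t≢ ]′ q
  where open Rule r

-- By the dangling condition, edges outside the match meet it only in K. So `G` is L with a context
-- attached along K, and attaching this context to R gives the result.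
derivation-exists : (r : Rule 𝓛) {G : TLRG 𝓛} (g : graph (Rule.L r) ↪ graph G) →
                    Dangling r g → ∃[ H ] DirectDerivation r G g H
derivation-exists r {G} g dangling = extend C R (_↪_.onV incR) ,
  transport-derivation (complement-≅ {X = L} {G = G} g _ boundary) g ((λ _ → refl) , (λ _ → refl))
    (extend-derivation C (rule-derivation r) _ _ λ k → k , refl , refl)
  where
  open Rule r
  boundary = Dangling⇒interface r g dangling
  C = complement {X = L} {G = G} g (_↪_.onV incL) boundary

-- Independence of matches and the Church-Rosser property

module _ (r : Rule 𝓛) where
  open Rule r
  private
    module L = TLRG L
    module K = Graph K
    module incL = _↪_ incL

  -- As L is totally labelled, an overlapping node brings its label and its rootedness into the
  -- overlap of the images; parallel independence then demands both in K.
  Retained : L.V → Set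
  Retained x = ∃[ k ] incL.onV k ≡ x × K.l k ≢ nothing × K.p k ≢ nothing

  defined? : {A : Set} (x : Maybe A) → Dec (x ≢ nothing)
  defined? (just _) = yes λ ()
  defined? nothing  = no λ ≢ → ≢ refl

  retained? : Decidable Retained
  retained? x = ∃?-fin K.V-fin λ k →
    ≟-fin L.V-fin (incL.onV k) x ×-dec defined? (K.l k) ×-dec defined? (K.p k)

module _ {r₁ r₂ : Rule 𝓛} {G : TLRG 𝓛} where
  private
    module G  = TLRG G
    module r₁ = Rule r₁
    module r₂ = Rule r₂
    module L₁ = TLRG r₁.L
    module L₂ = TLRG r₂.L
    module K₁ = Graph r₁.K
    module K₂ = Graph r₂.K
    module inc₁ = _↪_ r₁.incL
    module inc₂ = _↪_ r₂.incL

  -- Quantifies over the finitely many items of the left-hand sides, not over pairs of nodes and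
  -- labels, and is therefore decidable for any label alphabet.
  record Independent (g₁ : graph r₁.L ↪ graph G) (g₂ : graph r₂.L ↪ graph G) : Set where
    constructor independent
    private
      module g₁ = _↪_ g₁
      module g₂ = _↪_ g₂
    field
      onV : ∀ x₁ x₂ → g₁.onV x₁ ≡ g₂.onV x₂ → Retained r₁ x₁ × Retained r₂ x₂
      onE : ∀ x₁ x₂ → g₁.onE x₁ ≡ g₂.onE x₂ → x₁ ∈ im inc₁.onE × x₂ ∈ im inc₂.onE

  module _ (g₁ : graph r₁.L ↪ graph G) (g₂ : graph r₂.L ↪ graph G) where
    private
      module g₁ = _↪_ g₁
      module g₂ = _↪_ g₂

    independent? : Dec (Independent g₁ g₂)
    independent? = map′ (λ (p , q) → independent p q) (λ i → Independent.onV i , Independent.onE i)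
      ((∀?-fin L₁.V-fin λ x₁ → ∀?-fin L₂.V-fin λ x₂ →
          ≟-fin G.V-fin _ _ →-dec (retained? r₁ x₁ ×-dec retained? r₂ x₂))
       ×-dec
       (∀?-fin L₁.E-fin λ x₁ → ∀?-fin L₂.E-fin λ x₂ →
          ≟-fin G.E-fin _ _ →-dec (im? K₁.E-fin L₁.E-fin inc₁.onE x₁ ×-dec im? K₂.E-fin L₂.E-fin inc₂.onE x₂)))

    ⊑⇒Independent : image g₁ ⊓ image g₂ ⊑ image (g₁ ∘↪ r₁.incL) ⊓ image (g₂ ∘↪ r₂.incL) →
                    Independent g₁ g₂
    ⊑⇒Independent (nodes⊆ , edges⊆ , labels⊆ , roots⊆) = independent onV onE
      where
      just⇒defined : {A : Set} {x : Maybe A} {a : A} → x ≡ just a → x ≢ nothing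
      just⇒defined refl ()

      onV : ∀ x₁ x₂ → g₁.onV x₁ ≡ g₂.onV x₂ → Retained r₁ x₁ × Retained r₂ x₂
      onV x₁ x₂ q =
        let a , l↓ = just-total (L₁.l-total x₁)
            b , p↓ = just-total (L₁.p-total x₁)
            l↓₂ = trans (sym (↪-l {G = r₂.L} {H = G} g₂ x₂)) (trans (cong G.l (sym q)) (g₁.l-pres x₁ l↓))
            p↓₂ = trans (sym (↪-p {G = r₂.L} {H = G} g₂ x₂)) (trans (cong G.p (sym q)) (g₁.p-pres x₁ p↓))
            -- Labels and rootedness yield a priori different interface nodes; injectivity
            -- identifies them below.
            (k₁ , eq₁ , d₁) , (k₂ , eq₂ , d₂) = labels⊆ ((x₁ , refl , l↓) , (x₂ , sym q , l↓₂))
            (j₁ , eq₁′ , d₁′) , (j₂ , eq₂′ , d₂′) = roots⊆ ((x₁ , refl , p↓) , (x₂ , sym q , p↓₂))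
        in (k₁ , g₁.injV eq₁ , just⇒defined d₁ , just⇒defined
             (trans (cong K₁.p (inc₁.injV (g₁.injV (trans eq₁ (sym eq₁′))))) d₁′))
         , (k₂ , g₂.injV (trans eq₂ q) , just⇒defined d₂ , just⇒defined
             (trans (cong K₂.p (inc₂.injV (g₂.injV (trans eq₂ (sym eq₂′))))) d₂′))

      onE : ∀ x₁ x₂ → g₁.onE x₁ ≡ g₂.onE x₂ → x₁ ∈ im inc₁.onE × x₂ ∈ im inc₂.onE
      onE x₁ x₂ q =
        let (k₁ , eq₁) , (k₂ , eq₂) = edges⊆ ((x₁ , refl) , (x₂ , sym q))
        in (k₁ , g₁.injE eq₁) , (k₂ , g₂.injE (trans eq₂ q))

Independent-sym : {r₁ r₂ : Rule 𝓛} {G : TLRG 𝓛} {g₁ : graph (Rule.L r₁) ↪ graph G}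
                  {g₂ : graph (Rule.L r₂) ↪ graph G} →
                  Independent {r₁ = r₁} {r₂} {G} g₁ g₂ → Independent {r₁ = r₂} {r₁} {G} g₂ g₁
Independent-sym (independent onV onE) = independent
  (λ x₂ x₁ q → Product.swap (onV x₁ x₂ (sym q))) (λ x₂ x₁ q → Product.swap (onE x₁ x₂ (sym q)))

module Residual {r₁ r₂ : Rule 𝓛} {G H₁ : TLRG 𝓛} {g₁ : graph (Rule.L r₁) ↪ graph G}
                (δ₁ : DirectDerivation r₁ G g₁ H₁) (g₂ : graph (Rule.L r₂) ↪ graph G)
                (ind : Independent {r₁ = r₁} {r₂} {G} g₁ g₂) where
  private
    module r₁ = Rule r₁
    module r₂ = Rule r₂
    module G  = TLRG G
    module H₁ = TLRG H₁
    module g₂ = _↪_ g₂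
    module ind = Independent ind
    open module δ₁ = Derivation δ₁ using (module nodes; module edges)
    module h₁ = _↪_ (DirectDerivation.h δ₁)

  residualV : ∀ x → ∃ (g₂.onV x nodes.↝_)
  residualV x = nodes.survives (g₂.onV x) λ x₁ q →
    let (k , r , _) , _ = ind.onV x₁ x q in k , r

  residualE : ∀ x → ∃ (g₂.onE x edges.↝_)
  residualE x = edges.survives (g₂.onE x) λ x₁ q → proj₁ (ind.onE x₁ x q)

  retained₁ : ∀ {x k} → nodes.g (_↪_.onV r₁.incL k) ≡ g₂.onV x →
              Graph.l r₁.K k ≢ nothing × Graph.p r₁.K k ≢ nothing
  retained₁ q with ind.onV _ _ q
  ... | (k′ , r , l↓ , p↓) , _ with _↪_.injV r₁.incL r
  ...   | refl = l↓ , p↓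

  -- Items shared with the first match lie in `K₁` and survive; shared nodes have label and
  -- rootedness defined in `K₁`, so these are kept.
  residual : graph r₂.L ↪ graph H₁
  residual = record
    { morphism = record
      { onV = proj₁ ∘ residualV
      ; onE = proj₁ ∘ residualE
      ; s-pres = λ e → nodes.functional
          (subst (nodes._↝ H₁.s _) (g₂.s-pres e) (δ₁.s-track (proj₂ (residualE e)))) (proj₂ (residualV _))
      ; t-pres = λ e → nodes.functional
          (subst (nodes._↝ H₁.t _) (g₂.t-pres e) (δ₁.t-track (proj₂ (residualE e)))) (proj₂ (residualV _))
      ; m-pres = λ e → trans (sym (δ₁.m-track (proj₂ (residualE e)))) (g₂.m-pres e)
      ; l-pres = λ x l↓ → trans
          (Relabelling.kept δ₁.labels (proj₂ (residualV x)) λ k q → proj₁ (retained₁ q)) (g₂.l-pres x l↓)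
      ; p-pres = λ x p↓ → trans
          (Relabelling.kept δ₁.roots (proj₂ (residualV x)) λ k q → proj₂ (retained₁ q)) (g₂.p-pres x p↓)
      }
    ; injV = λ {x} {x′} q → g₂.injV (nodes.injective
        (proj₂ (residualV x)) (subst (_ nodes.↝_) (sym q) (proj₂ (residualV x′))))
    ; injE = λ {x} {x′} q → g₂.injE (edges.injective
        (proj₂ (residualE x)) (subst (_ edges.↝_) (sym q) (proj₂ (residualE x′))))
    }

  -- An old edge is traced back to `G`. If an edge from `R₁` ends in the residual match, that node
  -- lies in the overlap of the matches, so `r₂` does not delete it.
  residual-dangling : Dangling r₂ g₂ → Dangling r₂ residual
  residual-dangling dangling e e∉g₂ x x∉K with edges.cover e
  ... | inj₁ (e₀ , p) =
    let s≢ , t≢ = dangling e₀ (λ { (e′ , refl) → e∉g₂ (e′ , edges.functional (proj₂ (residualE e′)) p) }) x x∉K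
    in (λ q → s≢ (nodes.injective (δ₁.s-track p) (subst (_ nodes.↝_) (sym q) (proj₂ (residualV x)))))
     , (λ q → t≢ (nodes.injective (δ₁.t-track p) (subst (_ nodes.↝_) (sym q) (proj₂ (residualV x)))))
  ... | inj₂ (y , refl) =
      (λ q → created (trans (sym (h₁.s-pres y)) q))
    , (λ q → created (trans (sym (h₁.t-pres y)) q))
    where
    created : ∀ {w} → nodes.h w ≢ proj₁ (residualV x)
    created q with nodes.absorbed (proj₂ (residualV x)) q
    ... | k , _ , eq with ind.onV _ x eq
    ...   | _ , k₂ , r , _ = x∉K (k₂ , r)

module _ {r₁ r₂ : Rule 𝓛} {G : TLRG 𝓛} where
  private
    module r₁ = Rule r₁
    module r₂ = Rule r₂

  -- Both independence proofs are arguments so that exchanging the two steps gives an instance with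
  -- literally the same residual matches.
  confluence-simulation :
    ∀ {H₁ H₂ M₁ M₂ : TLRG 𝓛} {g₁ : graph r₁.L ↪ graph G} {g₂ : graph r₂.L ↪ graph G}
    (ind : Independent {r₁ = r₁} {r₂} {G} g₁ g₂) (ind′ : Independent {r₁ = r₂} {r₁} {G} g₂ g₁)
    (δ₁ : DirectDerivation r₁ G g₁ H₁) (δ₂ : DirectDerivation r₂ G g₂ H₂)
    (τ₂ : DirectDerivation r₂ H₁ (Residual.residual {r₁ = r₁} {r₂} {G} {H₁} δ₁ g₂ ind) M₁)
    (τ₁ : DirectDerivation r₁ H₂ (Residual.residual {r₁ = r₂} {r₁} {G} {H₂} δ₂ g₁ ind′) M₂) →
    Simulation M₁ M₂
      (Confluent (Derivation.nodes δ₁) (Derivation.nodes δ₂) (Derivation.nodes τ₂) (Derivation.nodes τ₁))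
      (Confluent (Derivation.edges δ₁) (Derivation.edges δ₂) (Derivation.edges τ₂) (Derivation.edges τ₁))
  confluence-simulation {g₁ = g₁} {g₂} ind ind′ δ₁ δ₂ τ₂ τ₁ = record
    { totalV      = Confluent-total ◇V
    ; totalE      = Confluent-total ◇E
    ; functionalV = Confluent-functional ◇V
    ; functionalE = Confluent-functional ◇E
    ; s-compat = λ { (old p p′ q q′) → old (δ₁.s-track p) (τ₂.s-track p′) (δ₂.s-track q) (τ₁.s-track q′)
                   ; (new₁ p refl) → new₁ (subst (τ₂.nodes._↝ _) (h.s-pres δ₁ _) (τ₂.s-track p)) (sym (h.s-pres τ₁ _))
                   ; (new₂ refl q) → new₂ (sym (h.s-pres τ₂ _)) (subst (τ₁.nodes._↝ _) (h.s-pres δ₂ _) (τ₁.s-track q)) }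
    ; t-compat = λ { (old p p′ q q′) → old (δ₁.t-track p) (τ₂.t-track p′) (δ₂.t-track q) (τ₁.t-track q′)
                   ; (new₁ p refl) → new₁ (subst (τ₂.nodes._↝ _) (h.t-pres δ₁ _) (τ₂.t-track p)) (sym (h.t-pres τ₁ _))
                   ; (new₂ refl q) → new₂ (sym (h.t-pres τ₂ _)) (subst (τ₁.nodes._↝ _) (h.t-pres δ₂ _) (τ₁.t-track q)) }
    ; m-compat = λ { (old p p′ q q′) → trans (sym (trans (δ₁.m-track p) (τ₂.m-track p′)))
                                             (trans (δ₂.m-track q) (τ₁.m-track q′))
                   ; (new₁ p refl) → trans (sym (τ₂.m-track p)) (trans (h.m-pres δ₁ _) (sym (h.m-pres τ₁ _)))
                   ; (new₂ refl q) → trans (h.m-pres τ₂ _) (trans (sym (h.m-pres δ₂ _)) (τ₁.m-track q)) }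
    ; l-compat = Confluent-label ◇V (≟-fin (TLRG.V-fin G)) δ₁.labels δ₂.labels τ₂.labels τ₁.labels
        λ k₁ k₂ q → proj₁ (ρ₂₁.retained₁ q) , proj₁ (ρ₁₂.retained₁ (sym q))
    ; p-compat = Confluent-label ◇V (≟-fin (TLRG.V-fin G)) δ₁.roots δ₂.roots τ₂.roots τ₁.roots
        λ k₁ k₂ q → proj₂ (ρ₂₁.retained₁ q) , proj₂ (ρ₁₂.retained₁ (sym q))
    }
    where
    module δ₁ = Derivation δ₁
    module δ₂ = Derivation δ₂
    module τ₁ = Derivation τ₁
    module τ₂ = Derivation τ₂
    module h {r : Rule _} {X Y : TLRG _} {g : graph (Rule.L r) ↪ graph X} (δ : DirectDerivation r X g Y) =
      _↪_ (DirectDerivation.h δ)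
    module ρ₂₁ = Residual δ₁ g₂ ind
    module ρ₁₂ = Residual δ₂ g₁ ind′

    ◇V : Diamond (nodeSpan r₁) (nodeSpan r₂) _ _ _ _ _
    ◇V = record
      { ρ₁ = δ₁.nodes ; ρ₂ = δ₂.nodes ; τ₂ = τ₂.nodes ; τ₁ = τ₁.nodes
      ; residual₁ = proj₂ ∘ ρ₁₂.residualV
      ; residual₂ = proj₂ ∘ ρ₂₁.residualV
      ; independent = λ x₁ x₂ q → Product.map (λ (k , r , _) → k , r) (λ (k , r , _) → k , r)
                                    (Independent.onV ind x₁ x₂ q)
      }

    ◇E : Diamond (edgeSpan r₁) (edgeSpan r₂) _ _ _ _ _
    ◇E = record
      { ρ₁ = δ₁.edges ; ρ₂ = δ₂.edges ; τ₂ = τ₂.edges ; τ₁ = τ₁.edges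
      ; residual₁ = proj₂ ∘ ρ₁₂.residualE
      ; residual₂ = proj₂ ∘ ρ₂₁.residualE
      ; independent = Independent.onE ind
      }

module _ {r₁ r₂ : Rule 𝓛} {G H₁ H₂ : TLRG 𝓛} {g₁ : graph (Rule.L r₁) ↪ graph G}
         {g₂ : graph (Rule.L r₂) ↪ graph G} where

  church-rosser : Independent {r₁ = r₁} {r₂} {G} g₁ g₂ →
    DirectDerivation r₁ G g₁ H₁ → DirectDerivation r₂ G g₂ H₂ →
    ∃[ M₁ ] ∃[ M₂ ] (∃[ g ] DirectDerivation r₂ H₁ g M₁) × (∃[ g ] DirectDerivation r₁ H₂ g M₂) ×
    (graph M₁ ≅ graph M₂)
  church-rosser ind δ₁ δ₂ = M₁ , M₂ , (_ , τ₂) , (_ , τ₁) ,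
    simulations⇒≅ {G = M₁} {H = M₂}
      (confluence-simulation ind ind′ δ₁ δ₂ τ₂ τ₁) (confluence-simulation ind′ ind δ₂ δ₁ τ₁ τ₂)
      Confluent-mirror Confluent-mirror Confluent-mirror Confluent-mirror
    where
    ind′ = Independent-sym ind
    module ρ₂ = Residual {r₁ = r₁} {r₂} {G} {H₁} δ₁ g₂ ind
    module ρ₁ = Residual {r₁ = r₂} {r₁} {G} {H₂} δ₂ g₁ ind′
    result₁ = derivation-exists r₂ {G = H₁} ρ₂.residual
                (ρ₂.residual-dangling (DirectDerivation.dangling δ₂))
    result₂ = derivation-exists r₁ {G = H₂} ρ₁.residual
                (ρ₁.residual-dangling (DirectDerivation.dangling δ₁))
    M₁ = proj₁ result₁
    M₂ = proj₁ result₂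
    τ₂ = proj₂ result₁
    τ₁ = proj₂ result₂

-- Restriction to the union of the matches

module _ (G : TLRG 𝓛) (PV : Pred (TLRG.V G) 0ℓ) (PE : Pred (TLRG.E G) 0ℓ)
         (PV? : Decidable PV) (PE? : Decidable PE)
         (s-closed : ∀ {e} → PE e → PV (TLRG.s G e)) (t-closed : ∀ {e} → PE e → PV (TLRG.t G e)) where
  private module G = TLRG G

  induced : TLRG 𝓛
  induced = record
    { graph = record
      { V = Refinement G.V PV ; E = Refinement G.E PE
      ; V-fin = proj₂ (Refinement-finite G.V-fin PV?)
      ; E-fin = proj₂ (Refinement-finite G.E-fin PE?)
      ; s = Refinement.map G.s s-closed
      ; t = Refinement.map G.t t-closed
      ; l = G.l ∘ value ; m = G.m ∘ value ; p = G.p ∘ value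
      }
    ; l-total = G.l-total ∘ value
    ; p-total = G.p-total ∘ value
    }

  induced-SubgraphOf : SubgraphOf G induced
  induced-SubgraphOf = record
    { onV = value ; onE = value ; injV = value-injective ; injE = value-injective
    ; s-restr = λ _ → refl ; t-restr = λ _ → refl ; m-restr = λ _ → refl
    ; l-restr = λ _ → refl ; p-restr = λ _ → refl
    }

  induced-↪ : graph induced ↪ graph G
  induced-↪ = record
    { morphism = record
      { onV = value ; onE = value
      ; s-pres = λ _ → refl ; t-pres = λ _ → refl ; m-pres = λ _ → refl
      ; l-pres = λ _ q → q ; p-pres = λ _ q → q
      }
    ; injV = value-injective
    ; injE = value-injective
    }

  corestrict : {X : Graph 𝓛} (f : X ↪ graph G) → (∀ v → PV (_↪_.onV f v)) → (∀ e → PE (_↪_.onE f e)) →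
               X ↪ graph induced
  corestrict f f∈V f∈E = record
    { morphism = record
      { onV = λ v → f.onV v , irr (f∈V v)
      ; onE = λ e → f.onE e , irr (f∈E e)
      ; s-pres = λ e → value-injective (f.s-pres e)
      ; t-pres = λ e → value-injective (f.t-pres e)
      ; m-pres = f.m-pres
      ; l-pres = f.l-pres
      ; p-pres = f.p-pres
      }
    ; injV = λ q → f.injV (cong value q)
    ; injE = λ q → f.injE (cong value q)
    }
    where module f = _↪_ f

  corestrict-dangling : {r : Rule 𝓛} (g : graph (Rule.L r) ↪ graph G)
    (g∈V : ∀ v → PV (_↪_.onV g v)) (g∈E : ∀ e → PE (_↪_.onE g e)) →
    Dangling r g → Dangling r (corestrict g g∈V g∈E)
  corestrict-dangling g g∈V g∈E dangling e e∉g x x∉K =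
    let s≢ , t≢ = dangling (value e) (λ (e′ , q) → e∉g (e′ , value-injective q)) x x∉K
    in s≢ ∘ cong value , t≢ ∘ cong value

-- Joining steps by isomorphism, commutation and embedding

module _ {T : R-GTSystem 𝓛} where
  open R-GTSystem T

  -- A sequence admits an isomorphism only at its end, so one at the front is absorbed into the
  -- match of the next step.
  ≅-◅◅ : {G G′ M : TLRG 𝓛} → graph G ≅ graph G′ → Steps T G′ M → Steps T G M
  ≅-◅◅ i (done j) = done (≅-trans i j)
  ≅-◅◅ {G} {G′} i (_◅_ {H} π σ) = record
    { index = index
    ; match = ≅⇒↪ (≅-sym i) ∘↪ match
    ; derivation = transport-derivation {G = G′} {G′ = G} {H = H} (≅-sym i) _
                     ((λ _ → refl) , (λ _ → refl)) derivation
    } ◅ σ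
    where open Step π

  module _ {G H₁ H₂ : TLRG 𝓛} (π₁ : Step T G H₁) (π₂ : Step T G H₂) where
    private
      module G  = TLRG G
      module π₁ = Step π₁
      module π₂ = Step π₂

    SameMatch? : Dec (SameMatch T π₁ π₂)
    SameMatch? with π₁.index Fin.≟ π₂.index
    ... | no ≢   = no (≢ ∘ proj₁)
    ... | yes eq = map′ (eq ,_)
        -- `SameMatch` may carry another proof that the indices are equal; uniqueness of identity
        -- proofs reduces it to `eq`.
        (λ { (eq′ , ≗) → subst Agree (uip eq′ eq) ≗ })
        (∀?-fin (TLRG.V-fin π₁.L) (λ _ → ≟-fin G.V-fin _ _) ×-dec
         ∀?-fin (TLRG.E-fin π₁.L) (λ _ → ≟-fin G.E-fin _ _))
      where
      Agree : π₁.index ≡ π₂.index → Set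
      Agree eq =
          (∀ v → _↪_.onV π₁.match v ≡ _↪_.onV π₂.match (subst (λ i → TLRG.V (Rule.L (rule i))) eq v))
        × (∀ e → _↪_.onE π₁.match e ≡ _↪_.onE π₂.match (subst (λ i → TLRG.E (Rule.L (rule i))) eq e))

    SameMatch⇒≅ : SameMatch T π₁ π₂ → graph H₁ ≅ graph H₂
    SameMatch⇒≅ (eq , ≗V , ≗E) = helper eq ≗V ≗E π₁.derivation π₂.derivation
      where
      -- The indices become variables so that `eq` can be matched with `refl`.
      helper : ∀ {i j} (eq : i ≡ j) {g₁ : graph (Rule.L (rule i)) ↪ graph G}
               {g₂ : graph (Rule.L (rule j)) ↪ graph G} →
               (∀ v → _↪_.onV g₁ v ≡ _↪_.onV g₂ (subst (λ i → TLRG.V (Rule.L (rule i))) eq v)) →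
               (∀ e → _↪_.onE g₁ e ≡ _↪_.onE g₂ (subst (λ i → TLRG.E (Rule.L (rule i))) eq e)) →
               DirectDerivation (rule i) G g₁ H₁ → DirectDerivation (rule j) G g₂ H₂ →
               graph H₁ ≅ graph H₂
      helper refl ≗V ≗E = result-unique {G = G} {H = H₁} {H′ = H₂} (≗V , ≗E)

    Independent⇒Joinable : Independent {r₁ = rule π₁.index} {rule π₂.index} {G} π₁.match π₂.match →
                           Joinable T H₁ H₂
    Independent⇒Joinable ind with church-rosser ind π₁.derivation π₂.derivation
    ... | M₁ , M₂ , (g₂ , τ₂) , (g₁ , τ₁) , i =
      M₂ , (record { index = π₂.index ; match = g₂ ; derivation = τ₂ } ◅ done i)
         , (record { index = π₁.index ; match = g₁ ; derivation = τ₁ } ◅ done ≅-refl)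

  module _ {S G : TLRG 𝓛} {B : Set} (C : Context 𝓛 B) (b : B → TLRG.V S)
           (i : graph (extend C S b) ≅ graph G) where

    -- The step of `G` and the extension of its restriction have the same match up to `i`, hence
    -- isomorphic results; from there `σ` is extended.
    embed-steps : {S′ H M : TLRG 𝓛} (π : Step T G H)
      (ĝ : graph (Step.L π) ↪ graph S) (δ̂ : DirectDerivation (rule (Step.index π)) S ĝ S′) →
      ≅⇒↪ i ∘↪ (extend-inc C (graph S) b ∘↪ ĝ) ≗↪ Step.match π →
      (σ : Steps T S′ M) (b″ : B → TLRG.V M) →
      (∀ j → track* (record { index = Step.index π ; match = ĝ ; derivation = δ̂ } ◅ σ) (b j) (b″ j)) →
      Steps T H (extend C M b″)
    embed-steps {S′} {H} {M} π ĝ δ̂ ≗ σ b″ tracked = ≅-◅◅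
      (result-unique {G = G} {H = H} {H′ = extend C S′ b′} ((λ _ → refl) , (λ _ → refl)) derivation
        (transport-derivation {G = extend C S b} {G′ = G} {H = extend C S′ b′} i match ≗
          (extend-derivation C {X = S} {Y = S′} δ̂ b b′ (proj₁ ∘ proj₂ ∘ tracked))))
      (extend-steps C σ b′ b″ (proj₂ ∘ proj₂ ∘ tracked))
      where
      open Step π
      b′ : B → TLRG.V S′
      b′ = proj₁ ∘ tracked

-- The critical pair inside a conflicting pair of steps

module Union {T : R-GTSystem 𝓛} {G H₁ H₂ : TLRG 𝓛} (π₁ : Step T G H₁) (π₂ : Step T G H₂) where
  private
    open R-GTSystem T
    module G  = TLRG G
    module π₁ = Step π₁
    module π₂ = Step π₂
    module L₁ = TLRG π₁.L
    module L₂ = TLRG π₂.L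
    module g₁ = _↪_ π₁.match
    module g₂ = _↪_ π₂.match

    PV : Pred G.V 0ℓ
    PV v = v ∈ im g₁.onV ⊎ v ∈ im g₂.onV

    PE : Pred G.E 0ℓ
    PE e = e ∈ im g₁.onE ⊎ e ∈ im g₂.onE

    PV? : Decidable PV
    PV? v = im? L₁.V-fin G.V-fin g₁.onV v ⊎-dec im? L₂.V-fin G.V-fin g₂.onV v

    PE? : Decidable PE
    PE? e = im? L₁.E-fin G.E-fin g₁.onE e ⊎-dec im? L₂.E-fin G.E-fin g₂.onE e

    s-closed : ∀ {e} → PE e → PV (G.s e)
    s-closed (inj₁ (x , refl)) = inj₁ (L₁.s x , sym (g₁.s-pres x))
    s-closed (inj₂ (x , refl)) = inj₂ (L₂.s x , sym (g₂.s-pres x))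

    t-closed : ∀ {e} → PE e → PV (G.t e)
    t-closed (inj₁ (x , refl)) = inj₁ (L₁.t x , sym (g₁.t-pres x))
    t-closed (inj₂ (x , refl)) = inj₂ (L₂.t x , sym (g₂.t-pres x))

  S : TLRG 𝓛
  S = induced G PV PE PV? PE? s-closed t-closed

  S≤G : SubgraphOf G S
  S≤G = induced-SubgraphOf G PV PE PV? PE? s-closed t-closed

  S↪G : graph S ↪ graph G
  S↪G = induced-↪ G PV PE PV? PE? s-closed t-closed

  ĝ₁ : graph π₁.L ↪ graph S
  ĝ₁ = corestrict G PV PE PV? PE? s-closed t-closed π₁.match
         (λ v → inj₁ (v , refl)) (λ e → inj₁ (e , refl))

  ĝ₂ : graph π₂.L ↪ graph S
  ĝ₂ = corestrict G PV PE PV? PE? s-closed t-closed π₂.match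
         (λ v → inj₂ (v , refl)) (λ e → inj₂ (e , refl))

  private
    result₁ = derivation-exists (rule π₁.index) {G = S} ĝ₁
      (corestrict-dangling G PV PE PV? PE? s-closed t-closed {r = rule π₁.index} π₁.match
        (λ v → inj₁ (v , refl)) (λ e → inj₁ (e , refl)) π₁.dangling)
    result₂ = derivation-exists (rule π₂.index) {G = S} ĝ₂
      (corestrict-dangling G PV PE PV? PE? s-closed t-closed {r = rule π₂.index} π₂.match
        (λ v → inj₂ (v , refl)) (λ e → inj₂ (e , refl)) π₂.dangling)

  Ŝ₁ Ŝ₂ : TLRG 𝓛
  Ŝ₁ = proj₁ result₁
  Ŝ₂ = proj₁ result₂

  π̂₁ : Step T S Ŝ₁
  π̂₁ = record { index = π₁.index ; match = ĝ₁ ; derivation = proj₂ result₁ }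

  π̂₂ : Step T S Ŝ₂
  π̂₂ = record { index = π₂.index ; match = ĝ₂ ; derivation = proj₂ result₂ }

  -- `S` contains both matches, so independence or equality of the restricted matches would carry
  -- over to `G`. Labels are covered along with nodes because the left-hand sides are totally
  -- labelled.
  critical : ¬ Independent {r₁ = rule π₁.index} {rule π₂.index} {G} π₁.match π₂.match →
             ¬ SameMatch T π₁ π₂ → CriticalPair T π̂₁ π̂₂
  critical ¬ind ¬same = record
    { covers = (λ {v} _ → coverV v)
             , (λ { {e , irr p} _ → Sum.map (map₂ value-injective) (map₂ value-injective)
                                       (recompute (PE? e) p) })
             , (λ { {v , a} q → Sum.map
                   (λ (x , r) → x , r , trans (sym (↪-l {G = π₁.L} {H = S} ĝ₁ x)) (trans (cong (TLRG.l S) r) q))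
                   (λ (x , r) → x , r , trans (sym (↪-l {G = π₂.L} {H = S} ĝ₂ x)) (trans (cong (TLRG.l S) r) q))
                   (coverV v) })
             , (λ { {v , a} q → Sum.map
                   (λ (x , r) → x , r , trans (sym (↪-p {G = π₁.L} {H = S} ĝ₁ x)) (trans (cong (TLRG.p S) r) q))
                   (λ (x , r) → x , r , trans (sym (↪-p {G = π₂.L} {H = S} ĝ₂ x)) (trans (cong (TLRG.p S) r) q))
                   (coverV v) })
    ; conflicting = λ pi →
        let independent onV onE = ⊑⇒Independent {r₁ = rule π₁.index} {rule π₂.index} {S} ĝ₁ ĝ₂ pi
        in ¬ind (independent (λ x₁ x₂ q → onV x₁ x₂ (value-injective q))
                             (λ x₁ x₂ q → onE x₁ x₂ (value-injective q)))
    ; distinct = λ (eq , ≗V , ≗E) → ¬same (eq , (λ v → cong value (≗V v)) , (λ e → cong value (≗E e)))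
    }
    where
    coverV : ∀ v → v ∈ im (_↪_.onV ĝ₁) ⊎ v ∈ im (_↪_.onV ĝ₂)
    -- The stored membership proof is irrelevant; deciding `PV` recovers which match contains the
    -- node.
    coverV (v , irr p) = Sum.map (map₂ value-injective) (map₂ value-injective) (recompute (PV? v) p)

  boundary-persistent : ∀ e → e ∉ im (_↪_.onE S↪G) → ∀ v →
    G.s e ≡ _↪_.onV S↪G v ⊎ G.t e ≡ _↪_.onV S↪G v → Persistent T π̂₁ π̂₂ v
  boundary-persistent e e∉S v q =
      Derivation.nodes.survives {H = Ŝ₁} (Step.derivation π̂₁) v (λ where
        x refl → Dangling⇒interface (rule π₁.index) π₁.match π₁.dangling e
          (λ (e′ , p) → e∉S ((e , irr (inj₁ (e′ , p))) , refl)) x q)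
    , Derivation.nodes.survives {H = Ŝ₂} (Step.derivation π̂₂) v (λ where
        x refl → Dangling⇒interface (rule π₂.index) π₂.match π₂.dangling e
          (λ (e′ , p) → e∉S ((e , irr (inj₂ (e′ , p))) , refl)) x q)

  joinable : StronglyJoinable T π̂₁ π̂₂ → Joinable T H₁ H₂
  joinable (M , σ₁ , σ₂ , agree) = extend C M b″
    , embed-steps {S = S} {G = G} C proj₁ S∪C≅G π₁ ĝ₁ (proj₂ result₁)
        ((λ _ → refl) , (λ _ → refl)) σ₁ b″ (λ (v , p) → proj₁ (proj₂ (agree v p)))
    , embed-steps {S = S} {G = G} C proj₁ S∪C≅G π₂ ĝ₂ (proj₂ result₂)
        ((λ _ → refl) , (λ _ → refl)) σ₂ b″ (λ (v , p) → proj₂ (proj₂ (agree v p)))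
    where
    -- Taking all persistent nodes with their evidence makes `agree` applicable to every attachment
    -- point.
    B = ∃ (Persistent T π̂₁ π̂₂)

    boundary : ∀ e → e ∉ im (_↪_.onE S↪G) → ∀ v →
               G.s e ≡ _↪_.onV S↪G v ⊎ G.t e ≡ _↪_.onV S↪G v → v ∈ im {B} proj₁
    boundary e e∉S v q = (v , boundary-persistent e e∉S v q) , refl

    C : Context 𝓛 B
    C = complement {X = S} {G = G} S↪G proj₁ boundary

    S∪C≅G : graph (extend C S proj₁) ≅ graph G
    S∪C≅G = complement-≅ {X = S} {G = G} S↪G proj₁ boundary

    -- The common image under both tracks: the two extended sequences thus end in the same graph,
    -- not merely in isomorphic ones.
    b″ : B → TLRG.V M
    b″ (v , p) = proj₁ (agree v p)

-- Local confluence from strongly joinable critical pairs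

theorem6p5 : ∀ {ℓ : Level} {𝓛 : LabelAlphabet} (T : R-GTSystem 𝓛) (D : GraphClass 𝓛 ℓ) →
    (∀ {G H₁ H₂ : TLRG 𝓛} (π₁ : Step T G H₁) (π₂ : Step T G H₂)
    (cp : CriticalPair T π₁ π₂) → NonGarbage T D cp → StronglyJoinable T π₁ π₂) →
    LocallyConfluentOn T D
theorem6p5 T D joinable {G} {H₁} {H₂} G∈D π₁ π₂
  with SameMatch? π₁ π₂ | independent? {G = G} (Step.match π₁) (Step.match π₂)
-- Such a pair is excluded from the critical pairs and need not be independent: a deleting step
-- conflicts with itself.
... | yes same | _       = H₂ , done (SameMatch⇒≅ π₁ π₂ same) , done ≅-refl
... | no _     | yes ind = Independent⇒Joinable π₁ π₂ ind
... | no ¬same | no ¬ind = union.joinable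
  (joinable union.π̂₁ union.π̂₂ (union.critical ¬ind ¬same) (sub union.S≤G (base G∈D)))
  where module union = Union π₁ π₂
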